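{- Let $G$ be the graph with vertex set $\{a_i,b_i,c_i : i\in[4]\}\cup\{q_i^j,r_i^j : i\in[4], j\in[2]\}$ (28 vertices) and the following edges, where indices of $a,b,c$ are taken so that $i\bmod 4+1$ follows $i$: the three four-cycles $a_ia_{i\bmod 4+1}$, $b_ib_{i\bmod 4+1}$, $c_ic_{i\bmod 4+1}$ for $i\in[4]$; the edges $q_i^j a_k, q_i^j b_k, q_i^j c_k$ for all $i,k\in[4]$, $j\in[2]$; the edges $r_i^jq_i^j$ for $i\in[4],j\in[2]$; and the edges $r_i^ja_i, r_i^ja_{i\bmod 4+1}, r_i^jb_i, r_i^jb_{i\bmod 4+1}, r_i^jc_i, r_i^jc_{i\bmod 4+1}$ for $i\in[4],j\in[2]$. Then $G$ does not admit a planar geometric storyplan.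
   Context: A storyplan of a graph $G$ on time steps $[\ell]=\{1,\dots,\ell\}$ is a pair $(A,\mathcal{D})$ where: $A$ assigns to each vertex $v$ a nonempty interval $A(v)=[s_v,e_v]\subseteq[\ell]$ of consecutive integers (the visible interval; $v$ is visible at each $t\in A(v)$); for every edge $uv$ we have $A(u)\cap A(v)\neq\emptyset$; and $\mathcal{D}$ assigns one fixed point to each vertex and one fixed curve to each edge. For $t\in[\ell]$, the frame at $t$ is the drawing under $\mathcal{D}$ of the induced subgraph $G[\{v : t\in A(v)\}]$. A storyplan is planar geometric if every frame is a planar drawing in which every edge is a straight-line segment. -}

module Defs where

open import Level using (0ℓ)
open import Data.Nat.Base as ℕ using (ℕ)
import Data.Nat.Properties as ℕ
open import Data.Nat.DivMod using (_mod_)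
open import Data.Fin.Base as Fin using (Fin; zero; suc; toℕ)
open import Data.Rational.Base as ℚ using (ℚ; 0ℚ; 1ℚ)
import Data.Rational.Properties as ℚ
open import Data.Rational.Solver using (module +-*-Solver)
open import Data.Product.Base using (Σ; Σ-syntax; ∃; ∃-syntax; _×_; _,_; proj₁)
open import Data.Sum.Base using (_⊎_; inj₁; inj₂; swap; [_,_]′)
open import Data.Refinement.Base using (Refinement; value)
open import Relation.Nullary.Negation.Core using (¬_)
open import Relation.Unary using (Pred; _∈_; _≐_)
open import Relation.Binary.PropositionalEquality.Core
  using (_≡_; _≢_; refl; sym; trans; cong; subst)

Cauchy : (ℕ → ℚ) → Set
Cauchy x = ∀ ε → 0ℚ ℚ.< ε →
  ∃[ N ] ∀ m n → N ℕ.≤ m → N ℕ.≤ n → ℚ.∣ x m ℚ.- x n ∣ ℚ.< ε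

-- Equality of reals is _≈_ below: the difference is a null sequence.
record ℝ : Set where
  constructor mkℝ
  field
    seq    : ℕ → ℚ
    cauchy : Cauchy seq

open ℝ public

half+half : ∀ ε → ε ℚ.* ℚ.½ ℚ.+ ε ℚ.* ℚ.½ ≡ ε
half+half ε =
  trans (sym (ℚ.*-distribˡ-+ ε ℚ.½ ℚ.½)) (ℚ.*-identityʳ ε)

half-pos : ∀ ε → 0ℚ ℚ.< ε → 0ℚ ℚ.< ε ℚ.* ℚ.½
half-pos ε 0<ε = ℚ.positive⁻¹ (ε ℚ.* ℚ.½)
  {{ℚ.pos*pos⇒pos ε {{ℚ.positive 0<ε}} ℚ.½}}

const-cauchy : ∀ q → Cauchy (λ _ → q)
const-cauchy q ε 0<ε = 0 , λ _ _ _ _ →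
  subst (λ d → ℚ.∣ d ∣ ℚ.< ε) (sym (ℚ.+-inverseʳ q)) 0<ε

+-cauchy : ∀ {x y} → Cauchy x → Cauchy y → Cauchy (λ n → x n ℚ.+ y n)
+-cauchy {x} {y} cx cy ε 0<ε
  with cx (ε ℚ.* ℚ.½) (half-pos ε 0<ε) | cy (ε ℚ.* ℚ.½) (half-pos ε 0<ε)
... | M , hM | N , hN = M ℕ.⊔ N , λ m n m≥ n≥ → begin-strict
  ℚ.∣ (x m ℚ.+ y m) ℚ.- (x n ℚ.+ y n) ∣
    ≡⟨ cong ℚ.∣_∣ (rearrange (x m) (y m) (x n) (y n)) ⟩
  ℚ.∣ (x m ℚ.- x n) ℚ.+ (y m ℚ.- y n) ∣
    ≤⟨ ℚ.∣p+q∣≤∣p∣+∣q∣ (x m ℚ.- x n) (y m ℚ.- y n) ⟩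
  ℚ.∣ x m ℚ.- x n ∣ ℚ.+ ℚ.∣ y m ℚ.- y n ∣
    <⟨ ℚ.+-mono-< (hM m n (ℕ.m⊔n≤o⇒m≤o M N m≥) (ℕ.m⊔n≤o⇒m≤o M N n≥))
                  (hN m n (ℕ.m⊔n≤o⇒n≤o M N m≥) (ℕ.m⊔n≤o⇒n≤o M N n≥)) ⟩
  ε ℚ.* ℚ.½ ℚ.+ ε ℚ.* ℚ.½
    ≡⟨ half+half ε ⟩
  ε ∎
  where
  open ℚ.≤-Reasoning
  open +-*-Solver
  rearrange : ∀ a b c d →
    (a ℚ.+ b) ℚ.- (c ℚ.+ d) ≡ (a ℚ.- c) ℚ.+ (b ℚ.- d)
  rearrange = solve 4 (λ a b c d →
    (a :+ b) :- (c :+ d) := (a :- c) :+ (b :- d)) refl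

neg-cauchy : ∀ {x} → Cauchy x → Cauchy (λ n → ℚ.- x n)
neg-cauchy {x} cx ε 0<ε with cx ε 0<ε
... | N , hN = N , λ m n m≥ n≥ →
  subst (ℚ._< ε)
    (trans (sym (ℚ.∣-p∣≡∣p∣ (x m ℚ.- x n)))
           (cong ℚ.∣_∣ (ℚ.neg-distrib-+ (x m) (ℚ.- x n))))
    (hN m n m≥ n≥)

bounded : ∀ {x} → Cauchy x →
  ∃[ B ] 0ℚ ℚ.< B × ∃[ N ] ∀ n → N ℕ.≤ n → ℚ.∣ x n ∣ ℚ.≤ B
bounded {x} cx with cx 1ℚ (ℚ.positive⁻¹ 1ℚ)
... | N , hN = 1ℚ ℚ.+ ℚ.∣ x N ∣
  , ℚ.+-mono-<-≤ (ℚ.positive⁻¹ 1ℚ) (ℚ.0≤∣p∣ (x N))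
  , N , λ n n≥ → begin
    ℚ.∣ x n ∣
      ≡⟨ cong ℚ.∣_∣ (split (x n) (x N)) ⟩
    ℚ.∣ (x n ℚ.- x N) ℚ.+ x N ∣
      ≤⟨ ℚ.∣p+q∣≤∣p∣+∣q∣ (x n ℚ.- x N) (x N) ⟩
    ℚ.∣ x n ℚ.- x N ∣ ℚ.+ ℚ.∣ x N ∣
      ≤⟨ ℚ.+-mono-≤ (ℚ.<⇒≤ (hN n N n≥ ℕ.≤-refl)) ℚ.≤-refl ⟩
    1ℚ ℚ.+ ℚ.∣ x N ∣ ∎
  where
  open ℚ.≤-Reasoning
  open +-*-Solver
  split : ∀ a b → a ≡ (a ℚ.- b) ℚ.+ b
  split = solve 2 (λ a b → a := (a :- b) :+ b) refl

quotient : ∀ ε D → 0ℚ ℚ.< ε → 0ℚ ℚ.< D → ∃[ δ ] 0ℚ ℚ.< δ × δ ℚ.* D ≡ ε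
quotient ε D 0<ε 0<D = ε ℚ.* ℚ.1/ D
    , ℚ.positive⁻¹ _ {{ℚ.pos*pos⇒pos ε (ℚ.1/ D) {{ℚ.1/pos⇒pos D}}}}
    , trans (ℚ.*-assoc ε (ℚ.1/ D) D)
      (trans (cong (ε ℚ.*_) (ℚ.*-inverseˡ D)) (ℚ.*-identityʳ ε))
  where
  instance
    ε-pos : ℚ.Positive ε
    ε-pos = ℚ.positive 0<ε
    D-pos : ℚ.Positive D
    D-pos = ℚ.positive 0<D
    D-nonZero : ℚ.NonZero D
    D-nonZero = ℚ.pos⇒nonZero D

∣p*q∣< : ∀ {δ B} p q → 0ℚ ℚ.< B → ℚ.∣ p ∣ ℚ.< δ → ℚ.∣ q ∣ ℚ.≤ B →
  ℚ.∣ p ℚ.* q ∣ ℚ.< δ ℚ.* B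
∣p*q∣< {δ} {B} p q 0<B p<δ q≤B = begin-strict
  ℚ.∣ p ℚ.* q ∣
    ≡⟨ ℚ.∣p*q∣≡∣p∣*∣q∣ p q ⟩
  ℚ.∣ p ∣ ℚ.* ℚ.∣ q ∣
    ≤⟨ ℚ.*-monoˡ-≤-nonNeg ℚ.∣ p ∣ {{ℚ.nonNegative (ℚ.0≤∣p∣ p)}} q≤B ⟩
  ℚ.∣ p ∣ ℚ.* B
    <⟨ ℚ.*-monoˡ-<-pos B {{ℚ.positive 0<B}} p<δ ⟩
  δ ℚ.* B ∎
  where open ℚ.≤-Reasoning

∣ab-cd∣< : ∀ {δ B C} a b c d → 0ℚ ℚ.< B → 0ℚ ℚ.< C →
  ℚ.∣ b ℚ.- d ∣ ℚ.< δ → ℚ.∣ a ∣ ℚ.≤ B →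
  ℚ.∣ a ℚ.- c ∣ ℚ.< δ → ℚ.∣ d ∣ ℚ.≤ C →
  ℚ.∣ a ℚ.* b ℚ.- c ℚ.* d ∣ ℚ.< δ ℚ.* (B ℚ.+ C)
∣ab-cd∣< {δ} {B} {C} a b c d 0<B 0<C b-d<δ a≤B a-c<δ d≤C = begin-strict
  ℚ.∣ a ℚ.* b ℚ.- c ℚ.* d ∣
    ≡⟨ cong ℚ.∣_∣ (rearrange a b c d) ⟩
  ℚ.∣ (b ℚ.- d) ℚ.* a ℚ.+ (a ℚ.- c) ℚ.* d ∣
    ≤⟨ ℚ.∣p+q∣≤∣p∣+∣q∣ ((b ℚ.- d) ℚ.* a) ((a ℚ.- c) ℚ.* d) ⟩
  ℚ.∣ (b ℚ.- d) ℚ.* a ∣ ℚ.+ ℚ.∣ (a ℚ.- c) ℚ.* d ∣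
    <⟨ ℚ.+-mono-< (∣p*q∣< (b ℚ.- d) a 0<B b-d<δ a≤B)
                  (∣p*q∣< (a ℚ.- c) d 0<C a-c<δ d≤C) ⟩
  δ ℚ.* B ℚ.+ δ ℚ.* C
    ≡⟨ sym (ℚ.*-distribˡ-+ δ B C) ⟩
  δ ℚ.* (B ℚ.+ C) ∎
  where
  open ℚ.≤-Reasoning
  open +-*-Solver
  rearrange : ∀ a b c d →
    a ℚ.* b ℚ.- c ℚ.* d ≡ (b ℚ.- d) ℚ.* a ℚ.+ (a ℚ.- c) ℚ.* d
  rearrange = solve 4 (λ a b c d →
    a :* b :- c :* d := (b :- d) :* a :+ (a :- c) :* d) refl

*-cauchy : ∀ {x y} → Cauchy x → Cauchy y → Cauchy (λ n → x n ℚ.* y n)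
*-cauchy {x} {y} cx cy ε 0<ε =
  let B , 0<B , K , hK = bounded cx
      C , 0<C , L , hL = bounded cy
      δ , 0<δ , δ-sum  = quotient ε (B ℚ.+ C) 0<ε (ℚ.+-mono-< 0<B 0<C)
      M , hM           = cx δ 0<δ
      N , hN           = cy δ 0<δ
  in (K ℕ.⊔ L) ℕ.⊔ (M ℕ.⊔ N) , λ m n m≥ n≥ →
    let KL  = K ℕ.⊔ L
        MN  = M ℕ.⊔ N
        K≤m = ℕ.m⊔n≤o⇒m≤o K L (ℕ.m⊔n≤o⇒m≤o KL MN m≥)
        L≤n = ℕ.m⊔n≤o⇒n≤o K L (ℕ.m⊔n≤o⇒m≤o KL MN n≥)
        M≤m = ℕ.m⊔n≤o⇒m≤o M N (ℕ.m⊔n≤o⇒n≤o KL MN m≥)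
        M≤n = ℕ.m⊔n≤o⇒m≤o M N (ℕ.m⊔n≤o⇒n≤o KL MN n≥)
        N≤m = ℕ.m⊔n≤o⇒n≤o M N (ℕ.m⊔n≤o⇒n≤o KL MN m≥)
        N≤n = ℕ.m⊔n≤o⇒n≤o M N (ℕ.m⊔n≤o⇒n≤o KL MN n≥)
    in subst (ℚ.∣ x m ℚ.* y m ℚ.- x n ℚ.* y n ∣ ℚ.<_) δ-sum
         (∣ab-cd∣< (x m) (y m) (x n) (y n) 0<B 0<C
           (hN m n N≤m N≤n) (hK m K≤m) (hM m n M≤m M≤n) (hL n L≤n))

fromℚ : ℚ → ℝ
fromℚ q = mkℝ (λ _ → q) (const-cauchy q)

0ℝ 1ℝ : ℝ
0ℝ = fromℚ 0ℚ
1ℝ = fromℚ 1ℚ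

infixl 6 _+_ _-_
infixl 7 _*_
infix  8 -_
infix  4 _≈_ _<_ _≤_

_+_ _*_ : ℝ → ℝ → ℝ
x + y = mkℝ (λ n → seq x n ℚ.+ seq y n) (+-cauchy {seq x} {seq y} (cauchy x) (cauchy y))
x * y = mkℝ (λ n → seq x n ℚ.* seq y n) (*-cauchy {seq x} {seq y} (cauchy x) (cauchy y))

-_ : ℝ → ℝ
- x = mkℝ (λ n → ℚ.- seq x n) (neg-cauchy {seq x} (cauchy x))

_-_ : ℝ → ℝ → ℝ
x - y = x + (- y)

_≈_ _<_ _≤_ : ℝ → ℝ → Set
x ≈ y = ∀ ε → 0ℚ ℚ.< ε →
  ∃[ N ] ∀ n → N ℕ.≤ n → ℚ.∣ seq x n ℚ.- seq y n ∣ ℚ.< ε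
x < y = ∃[ ε ] 0ℚ ℚ.< ε ×
  ∃[ N ] ∀ n → N ℕ.≤ n → seq x n ℚ.+ ε ℚ.< seq y n
x ≤ y = ¬ y < x

Point : Set
Point = ℝ × ℝ

infix 4 _≈ₚ_

_≈ₚ_ : Point → Point → Set
(x , y) ≈ₚ (x′ , y′) = x ≈ x′ × y ≈ y′

Within : ℝ → ℝ → ℝ → Set
Within ε x y = - ε < x - y × x - y < ε

-- The distance on the plane is the maximum of the coordinate distances.
Withinₚ : ℝ → Point → Point → Set
Withinₚ ε (x , y) (x′ , y′) = Within ε x x′ × Within ε y y′

UnitInterval : Set
UnitInterval = Σ[ t ∈ ℝ ] (0ℝ ≤ t × t ≤ 1ℝ)

fromℚ-mono : ∀ {p q} → p ℚ.≤ q → fromℚ p ≤ fromℚ q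
fromℚ-mono {p} {q} p≤q (ε , 0<ε , N , h) = ℚ.<-irrefl refl (begin-strict
  q           ≡⟨ sym (ℚ.+-identityʳ q) ⟩
  q ℚ.+ 0ℚ    <⟨ ℚ.+-mono-≤-< (ℚ.≤-refl {q}) 0<ε ⟩
  q ℚ.+ ε     <⟨ h N ℕ.≤-refl ⟩
  p           ≤⟨ p≤q ⟩
  q           ∎)
  where open ℚ.≤-Reasoning

0∈I 1∈I : UnitInterval
0∈I = 0ℝ , fromℚ-mono ℚ.≤-refl , fromℚ-mono (ℚ.nonNegative⁻¹ 1ℚ)
1∈I = 1ℝ , fromℚ-mono (ℚ.nonNegative⁻¹ 1ℚ) , fromℚ-mono ℚ.≤-refl

record Curve : Set where
  field
    path       : UnitInterval → Point
    continuous : ∀ s ε → 0ℝ < ε → ∃[ δ ] 0ℝ < δ ×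
                 (∀ t → Within δ (proj₁ s) (proj₁ t) →
                        Withinₚ ε (path s) (path t))

  source target : Point
  source = path 0∈I
  target = path 1∈I

  image : Pred Point 0ℓ
  image p = ∃[ t ] p ≈ₚ path t

  Simple : Set
  Simple = ∀ s t → path s ≈ₚ path t → proj₁ s ≈ proj₁ t

open Curve public

segment : Point → Point → Pred Point 0ℓ
segment (x₀ , y₀) (x₁ , y₁) p = Σ[ (t , _) ∈ UnitInterval ]
  p ≈ₚ (x₀ + t * (x₁ - x₀) , y₀ + t * (y₁ - y₀))

record Graph : Set₁ where
  infix 4 _~_
  field
    Vertex : Set
    _~_    : Vertex → Vertex → Set
    ~-sym  : ∀ {u v} → u ~ v → v ~ u
    ~-irr  : ∀ {u v} → u ~ v → u ≢ v

induced : (G : Graph) → (Graph.Vertex G → Set) → Graph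
induced G P = record
  { Vertex = Refinement Vertex P
  ; _~_    = λ u v → value u ~ value v
  ; ~-sym  = ~-sym
  ; ~-irr  = λ e u≡v → ~-irr e (cong value u≡v)
  }
  where open Graph G

-- An edge uv is given both as u ~ v and as v ~ u; curve-unoriented says that
-- it nevertheless has a single curve, up to parametrisation.
record Drawing (G : Graph) : Set where
  open Graph G
  field
    point            : Vertex → Point
    curve            : ∀ {u v} → u ~ v → Curve
    curve-source     : ∀ {u v} (e : u ~ v) → source (curve e) ≈ₚ point u
    curve-target     : ∀ {u v} (e : u ~ v) → target (curve e) ≈ₚ point v
    curve-unoriented : ∀ {u v} (e : u ~ v) (f : v ~ u) →
                       image (curve e) ≐ image (curve f)

restrict : ∀ {G} → Drawing G → (P : Graph.Vertex G → Set) →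
           Drawing (induced G P)
restrict D P = record
  { point            = λ v → point (value v)
  ; curve            = curve
  ; curve-source     = curve-source
  ; curve-target     = curve-target
  ; curve-unoriented = curve-unoriented
  }
  where open Drawing D

module _ {G : Graph} (D : Drawing G) where
  open Graph G
  open Drawing D

  record Planar : Set where
    field
      points-distinct : ∀ {u v} → u ≢ v → ¬ point u ≈ₚ point v
      curves-simple   : ∀ {u v} (e : u ~ v) → Simple (curve e)
      curves-avoid    : ∀ {u v} (e : u ~ v) {w} → w ≢ u → w ≢ v →
                        ¬ point w ∈ image (curve e)
      curves-cross    : ∀ {u v w x} (e : u ~ v) (f : w ~ x) →
                        ¬ (u ≡ w × v ≡ x ⊎ u ≡ x × v ≡ w) →
                        ∀ {p} → p ∈ image (curve e) → p ∈ image (curve f) →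
                        ∃[ y ] (y ≡ u ⊎ y ≡ v) × (y ≡ w ⊎ y ≡ x) ×
                               p ≈ₚ point y

  StraightLine : Set
  StraightLine = ∀ {u v} (e : u ~ v) →
                 image (curve e) ≐ segment (point u) (point v)

record Storyplan (G : Graph) (ℓ : ℕ) : Set where
  open Graph G
  field
    first last : Vertex → Fin ℓ
    nonempty   : ∀ v → first v Fin.≤ last v

  Visible : Fin ℓ → Vertex → Set
  Visible t v = first v Fin.≤ t × t Fin.≤ last v

  field
    meet    : ∀ {u v} → u ~ v → ∃[ t ] Visible t u × Visible t v
    drawing : Drawing G

  frame : (t : Fin ℓ) → Drawing (induced G (Visible t))
  frame t = restrict drawing (Visible t)

PlanarGeometric : ∀ {G ℓ} → Storyplan G ℓ → Set
PlanarGeometric S = ∀ t → Planar (frame t) × StraightLine (frame t)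
  where open Storyplan S

AdmitsPlanarGeometricStoryplan : Graph → Set
AdmitsPlanarGeometricStoryplan G =
  ∃[ ℓ ] Σ[ S ∈ Storyplan G ℓ ] PlanarGeometric S

data V : Set where
  a b c : Fin 4 → V
  q r   : Fin 4 → Fin 2 → V

next : Fin 4 → Fin 4
next i = ℕ.suc (toℕ i) mod 4

infix 4 _⟶_

data _⟶_ : V → V → Set where
  aa : ∀ i → a i ⟶ a (next i)
  bb : ∀ i → b i ⟶ b (next i)
  cc : ∀ i → c i ⟶ c (next i)
  qa : ∀ i j k → q i j ⟶ a k
  qb : ∀ i j k → q i j ⟶ b k
  qc : ∀ i j k → q i j ⟶ c k
  rq : ∀ i j → r i j ⟶ q i j
  ra : ∀ i j → r i j ⟶ a i
  rb : ∀ i j → r i j ⟶ b i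
  rc : ∀ i j → r i j ⟶ c i
  ra′ : ∀ i j → r i j ⟶ a (next i)
  rb′ : ∀ i j → r i j ⟶ b (next i)
  rc′ : ∀ i j → r i j ⟶ c (next i)

⟶-irr : ∀ {u v} → u ⟶ v → u ≢ v
⟶-irr (aa zero) ()
⟶-irr (aa (suc zero)) ()
⟶-irr (aa (suc (suc zero))) ()
⟶-irr (aa (suc (suc (suc zero)))) ()
⟶-irr (bb zero) ()
⟶-irr (bb (suc zero)) ()
⟶-irr (bb (suc (suc zero))) ()
⟶-irr (bb (suc (suc (suc zero)))) ()
⟶-irr (cc zero) ()
⟶-irr (cc (suc zero)) ()
⟶-irr (cc (suc (suc zero))) ()
⟶-irr (cc (suc (suc (suc zero)))) ()

𝔾 : Graph
𝔾 = record
  { Vertex = V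
  ; _~_    = λ u v → u ⟶ v ⊎ v ⟶ u
  ; ~-sym  = swap
  ; ~-irr  = [ ⟶-irr , (λ e u≡v → ⟶-irr e (sym u≡v)) ]′
  }

-- Call the cycles a, b, c rings.  If the rings have no common time, then two
-- ring vertices with disjoint intervals force all q's to be visible at once,
-- and three consecutive vertices of a are visible together with all of them.
-- The triangles over one edge on the same side are nested, so the third
-- vertex distinguishes two of the q's on each side, which is too few.
--
-- Otherwise the rings share a window of time, meeting every q.  Two q's cannot
-- be seen at once in it: a ring separates them unless one of them lies in a
-- triangle of the other and a side of the ring, and each q allows this for
-- one of the three rings only.  If r i j also meets the window, then
-- for at least two rings q i j has side i as its far side, i.e. the triangle
-- of q i j and side i contains the rest of the ring.  A ring has no two
-- opposite far sides, even as seen from two different points.  So of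
-- opposite positions i, i + 2 at most one has an r meeting the window; hence
-- two positions i have both r's missing it, but each such r pins its q at an
-- end of the window, where only one q is visible.

module Submission where

open import Defs
open import Relation.Nullary.Negation.Core using (¬_)
open import Data.Empty using (⊥; ⊥-elim)
open import Data.Fin.Base as Fin using (Fin; zero; suc)
open import Data.Fin.Patterns using (0F; 1F; 2F; 3F)
import Data.Fin.Properties as Fin
open import Data.Irrelevant using ([_])
open import Data.Nat.Base as ℕ using (ℕ)
import Data.Nat.Properties as ℕ
open import Data.Product.Base as Product using (_×_; _,_; ∃-syntax; proj₁; proj₂; uncurry)
open import Data.Rational.Base as ℚ using (ℚ; 0ℚ; 1ℚ)
import Data.Rational.Properties as ℚ
open import Data.Rational.Solver using (module +-*-Solver)
open import Data.Refinement.Base using (Refinement; value; _,_)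
open import Data.Sum.Base as Sum using (_⊎_; inj₁; inj₂; [_,_]′)
open import Effect.Monad using (RawMonad)
open import Relation.Binary.PropositionalEquality
  using (_≡_; _≢_; refl; sym; trans; cong; cong₂; subst; subst₂; ≢-sym)
open import Relation.Nullary using (Dec; yes; no)
open import Relation.Nullary.Decidable
  using (¬¬-excluded-middle; decidable-stable; map′; _×-dec_; _⊎-dec_)
open import Relation.Nullary.Negation using (¬¬-Monad)
open import Relation.Unary using (_∈_)
open +-*-Solver using (Polynomial; solve; con; _:+_; _:*_; _:-_; :-_; _:=_)

-- Signs, equality and inverses of Cauchy reals

-- Records rather than synonyms, so that x is determined by the type Pos x.
record Pos (x : ℝ) : Set where
  constructor pos
  field
    bound   : ℚ
    0<bound : 0ℚ ℚ.< bound
    from    : ℕ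
    above   : ∀ n → from ℕ.≤ n → bound ℚ.< seq x n

-- Stated negatively, so that it follows from the mere failure of positivity.
record NonNeg (x : ℝ) : Set where
  constructor nonneg
  field ¬neg : ¬ Pos (- x)

infix 4 _≃_

-- Finer than `_≈_`: polynomial identities hold term by term, and inverses are exact once the
-- sequence exceeds its bound.
record _≃_ (x y : ℝ) : Set where
  constructor eventually
  field
    from  : ℕ
    equal : ∀ n → from ℕ.≤ n → seq x n ≡ seq y n

pointwise : ∀ {x y} → (∀ n → seq x n ≡ seq y n) → x ≃ y
pointwise h = eventually 0 (λ n _ → h n)

≃⇒≈ : ∀ {x y} → x ≃ y → x ≈ y
≃⇒≈ {x} {y} (eventually N h) ε 0<ε = N , λ n n≥ →
  subst (λ d → ℚ.∣ d ∣ ℚ.< ε)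
    (sym (trans (cong (ℚ._- seq y n) (h n n≥)) (ℚ.+-inverseʳ (seq y n)))) 0<ε

Pos-resp-≃ : ∀ {x y} → x ≃ y → Pos x → Pos y
Pos-resp-≃ (eventually M hM) (pos ε 0<ε N hN) = pos ε 0<ε (M ℕ.⊔ N) λ n n≥ →
  subst (ε ℚ.<_) (hM n (ℕ.m⊔n≤o⇒m≤o M N n≥)) (hN n (ℕ.m⊔n≤o⇒n≤o M N n≥))

Pos-resp : ∀ {x y} → (∀ n → seq x n ≡ seq y n) → Pos x → Pos y
Pos-resp h = Pos-resp-≃ (pointwise h)

neg-involutive : ∀ s → ℚ.- (ℚ.- s) ≡ s
neg-involutive = solve 1 (λ s → :- (:- s) := s) refl

NonNeg-resp : ∀ {x y} → (∀ n → seq x n ≡ seq y n) → NonNeg x → NonNeg y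
NonNeg-resp h (nonneg ¬-x) =
  nonneg λ -y → ¬-x (Pos-resp (λ n → cong ℚ.-_ (sym (h n))) -y)

¬Pos⇒NonNeg-neg : ∀ {x} → ¬ Pos x → NonNeg (- x)
¬Pos⇒NonNeg-neg {x} ¬x = nonneg λ p → ¬x (Pos-resp (λ n → neg-involutive (seq x n)) p)

<⇒Pos : ∀ {x y} → x < y → Pos (y - x)
<⇒Pos {x} {y} (ε , 0<ε , N , h) = pos ε 0<ε N λ n n≥ →
  subst (ℚ._< seq y n ℚ.- seq x n) (cancel (seq x n) ε)
    (ℚ.+-monoˡ-< (ℚ.- seq x n) (h n n≥))
  where
  cancel : ∀ s e → (s ℚ.+ e) ℚ.- s ≡ e
  cancel = solve 2 (λ s e → (s :+ e) :- s := e) refl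

NonNeg⇒≤ : ∀ {x y} → NonNeg (y - x) → x ≤ y
NonNeg⇒≤ {x} {y} (nonneg ¬neg) y<x =
  ¬neg (Pos-resp (λ n → swap′ (seq x n) (seq y n)) (<⇒Pos {y} {x} y<x))
  where
  swap′ : ∀ s t → s ℚ.- t ≡ ℚ.- (t ℚ.- s)
  swap′ = solve 2 (λ s t → s :- t := :- (t :- s)) refl

Pos-irrefl : ∀ {x} → (∀ n → seq x n ≡ 0ℚ) → ¬ Pos x
Pos-irrefl h (pos ε 0<ε N hN) =
  ℚ.<-asym 0<ε (subst (ε ℚ.<_) (h N) (hN N ℕ.≤-refl))

+-pos : ∀ {x y} → Pos x → Pos y → Pos (x + y)
+-pos (pos ε 0<ε M hM) (pos η 0<η N hN) =
  pos (ε ℚ.+ η) (ℚ.+-mono-< 0<ε 0<η) (M ℕ.⊔ N) λ n n≥ →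
    ℚ.+-mono-< (hM n (ℕ.m⊔n≤o⇒m≤o M N n≥)) (hN n (ℕ.m⊔n≤o⇒n≤o M N n≥))

ℚ-*-pos : ∀ {s t} → 0ℚ ℚ.< s → 0ℚ ℚ.< t → 0ℚ ℚ.< s ℚ.* t
ℚ-*-pos {s} {t} 0<s 0<t =
  ℚ.positive⁻¹ (s ℚ.* t) {{ℚ.pos*pos⇒pos s {{ℚ.positive 0<s}} t {{ℚ.positive 0<t}}}}

*-pos : ∀ {x y} → Pos x → Pos y → Pos (x * y)
*-pos {x} {y} (pos ε 0<ε M hM) (pos η 0<η N hN) =
  pos (ε ℚ.* η) (ℚ-*-pos 0<ε 0<η) (M ℕ.⊔ N) λ n n≥ →
    let ε<x = hM n (ℕ.m⊔n≤o⇒m≤o M N n≥)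
        η<y = hN n (ℕ.m⊔n≤o⇒n≤o M N n≥)
    in begin-strict
      ε ℚ.* η           <⟨ ℚ.*-monoʳ-<-pos ε {{ℚ.positive 0<ε}} η<y ⟩
      ε ℚ.* seq y n     <⟨ ℚ.*-monoˡ-<-pos (seq y n)
                             {{ℚ.positive (ℚ.<-trans 0<η η<y)}} ε<x ⟩
      seq x n ℚ.* seq y n ∎
  where open ℚ.≤-Reasoning

∣s∣<t⇒ : ∀ {s t} → ℚ.∣ s ∣ ℚ.< t → s ℚ.< t × ℚ.- t ℚ.< s
∣s∣<t⇒ {s} {t} ∣s∣<t with ℚ.∣p∣≡p∨∣p∣≡-p s
... | inj₁ ≡s = subst (ℚ._< t) ≡s ∣s∣<t , ℚ.<-≤-trans (ℚ.neg-antimono-< 0<t) 0≤s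
  where
  0≤s = subst (0ℚ ℚ.≤_) ≡s (ℚ.0≤∣p∣ s)
  0<t = ℚ.≤-<-trans (ℚ.0≤∣p∣ s) ∣s∣<t
... | inj₂ ≡-s = ℚ.≤-<-trans s≤0 0<t
    , subst (ℚ.- t ℚ.<_) (neg-involutive s) (ℚ.neg-antimono-< (subst (ℚ._< t) ≡-s ∣s∣<t))
  where
  0<t = ℚ.≤-<-trans (ℚ.0≤∣p∣ s) ∣s∣<t
  s≤0 = subst (ℚ._≤ 0ℚ) (neg-involutive s)
          (ℚ.neg-antimono-≤ (subst (0ℚ ℚ.≤_) ≡-s (ℚ.0≤∣p∣ s)))

∣s∣<t : ∀ {s t} → s ℚ.< t → ℚ.- t ℚ.< s → ℚ.∣ s ∣ ℚ.< t
∣s∣<t {s} {t} s<t -t<s with ℚ.∣p∣≡p∨∣p∣≡-p s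
... | inj₁ ≡s = subst (ℚ._< t) (sym ≡s) s<t
... | inj₂ ≡-s = subst (ℚ._< t) (sym ≡-s)
  (subst (ℚ.- s ℚ.<_) (neg-involutive t) (ℚ.neg-antimono-< -t<s))

-- A late term at or below `- δ` would, by the Cauchy property at δ/2, keep every term from `N` on
-- below -δ/2 and so make `- x` positive.
NonNeg-lower : ∀ {x} → NonNeg x → ∀ δ → 0ℚ ℚ.< δ →
               ∃[ N ] ∀ n → N ℕ.≤ n → ℚ.- δ ℚ.< seq x n
NonNeg-lower {x} (nonneg ¬-x) δ 0<δ =
  let N , hN = cauchy x η 0<η in N , λ n n≥ →
    ℚ.≰⇒> λ xn≤-δ → ¬-x (pos η 0<η N λ m m≥ → begin-strict
      η
        ≡⟨ halve η ⟩
      (η ℚ.+ η) ℚ.+ ℚ.- η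
        ≡⟨ cong (ℚ._+ ℚ.- η) (half+half δ) ⟩
      δ ℚ.+ ℚ.- η
        ≡⟨ cong (ℚ._+ ℚ.- η) (sym (neg-involutive δ)) ⟩
      ℚ.- (ℚ.- δ) ℚ.+ ℚ.- η
        <⟨ ℚ.+-mono-≤-< (ℚ.neg-antimono-≤ xn≤-δ) (proj₂ (∣s∣<t⇒ (hN n m n≥ m≥))) ⟩
      ℚ.- seq x n ℚ.+ (seq x n ℚ.- seq x m)
        ≡⟨ cancel (seq x n) (seq x m) ⟩
      ℚ.- seq x m ∎)
  where
  open ℚ.≤-Reasoning
  η = δ ℚ.* ℚ.½
  0<η = half-pos δ 0<δ
  halve : ∀ e → e ≡ (e ℚ.+ e) ℚ.+ ℚ.- e
  halve = solve 1 (λ e → e := (e :+ e) :+ :- e) refl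
  cancel : ∀ s t → ℚ.- s ℚ.+ (s ℚ.- t) ≡ ℚ.- t
  cancel = solve 2 (λ s t → :- s :+ (s :- t) := :- t) refl

pos+nonneg : ∀ {x y} → Pos x → NonNeg y → Pos (x + y)
pos+nonneg {x} {y} (pos ε 0<ε M hM) 0≤y =
  let N , hN = NonNeg-lower 0≤y η (half-pos ε 0<ε)
  in pos η (half-pos ε 0<ε) (M ℕ.⊔ N) λ n n≥ →
    subst (ℚ._< seq x n ℚ.+ seq y n)
      (trans (cong (ℚ._+ ℚ.- η) (sym (half+half ε))) (halve η))
      (ℚ.+-mono-< (hM n (ℕ.m⊔n≤o⇒m≤o M N n≥)) (hN n (ℕ.m⊔n≤o⇒n≤o M N n≥)))
  where
  η = ε ℚ.* ℚ.½
  halve : ∀ e → (e ℚ.+ e) ℚ.+ ℚ.- e ≡ e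
  halve = solve 1 (λ e → (e :+ e) :+ :- e := e) refl

NonNeg-antisym : ∀ {x} → NonNeg x → NonNeg (- x) → x ≈ 0ℝ
NonNeg-antisym {x} 0≤x 0≤-x ε 0<ε =
  let M , hM = NonNeg-lower 0≤x ε 0<ε
      N , hN = NonNeg-lower 0≤-x ε 0<ε
  in M ℕ.⊔ N , λ n n≥ →
    subst (λ d → ℚ.∣ d ∣ ℚ.< ε) (sym (ℚ.+-identityʳ (seq x n)))
      (∣s∣<t (subst₂ ℚ._<_ (neg-involutive (seq x n)) (neg-involutive ε)
                (ℚ.neg-antimono-< (hN n (ℕ.m⊔n≤o⇒n≤o M N n≥))))
             (hM n (ℕ.m⊔n≤o⇒m≤o M N n≥)))

*-zeroʳ-≈ : ∀ w {z} → z ≈ 0ℝ → w * z ≈ 0ℝ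
*-zeroʳ-≈ w {z} z≈0 ε 0<ε =
  let B , 0<B , M , hM = bounded {seq w} (cauchy w)
      δ , 0<δ , δB≡ε   = quotient ε B 0<ε 0<B
      N , hN           = z≈0 δ 0<δ
  in M ℕ.⊔ N , λ n n≥ →
    subst₂ (λ d e → ℚ.∣ d ∣ ℚ.< e) (regroup (seq w n) (seq z n)) δB≡ε
      (∣p*q∣< {δ} {B} (seq z n ℚ.- 0ℚ) (seq w n) 0<B
        (hN n (ℕ.m⊔n≤o⇒n≤o M N n≥)) (hM n (ℕ.m⊔n≤o⇒m≤o M N n≥)))
  where
  regroup : ∀ s t → (t ℚ.- 0ℚ) ℚ.* s ≡ s ℚ.* t ℚ.- 0ℚ
  regroup = solve 2 (λ s t → (t :- con 0ℚ) :* s := s :* t :- con 0ℚ) refl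

-- Clamping the terms below by `ε` makes every one of them invertible, with inverses at most 1/ε.
-- From `N` on the clamping changes nothing, hence the eventual equality.
inverse : ∀ {x} → Pos x → ∃[ y ] (x * y) ≃ 1ℝ
inverse {x} (pos ε 0<ε N hN) = mkℝ g g-cauchy , eventually N λ n n≥ →
    trans (cong (ℚ._* g n) (sym (u≡x n n≥))) (u*g≡1 n)
  where
  open ℚ.≤-Reasoning

  u : ℕ → ℚ
  u n = seq x n ℚ.⊔ ε

  0<u : ∀ n → 0ℚ ℚ.< u n
  0<u n = ℚ.<-≤-trans 0<ε (ℚ.p≤q⊔p (seq x n) ε)

  reciprocal : ∀ s → 0ℚ ℚ.< s → ∃[ t ] 0ℚ ℚ.< t × t ℚ.* s ≡ 1ℚ
  reciprocal s = quotient 1ℚ s (ℚ.positive⁻¹ 1ℚ)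

  g : ℕ → ℚ
  g n = proj₁ (reciprocal (u n) (0<u n))

  0<g : ∀ n → 0ℚ ℚ.< g n
  0<g n = proj₁ (proj₂ (reciprocal (u n) (0<u n)))

  u*g≡1 : ∀ n → u n ℚ.* g n ≡ 1ℚ
  u*g≡1 n = trans (ℚ.*-comm (u n) (g n)) (proj₂ (proj₂ (reciprocal (u n) (0<u n))))

  u≡x : ∀ n → N ℕ.≤ n → u n ≡ seq x n
  u≡x n n≥ = ℚ.p≥q⇒p⊔q≡p (ℚ.<⇒≤ (hN n n≥))

  e = proj₁ (reciprocal ε 0<ε)

  0<e : 0ℚ ℚ.< e
  0<e = proj₁ (proj₂ (reciprocal ε 0<ε))

  g≤e : ∀ n → g n ℚ.≤ e
  g≤e n = begin
    g n                   ≡⟨ sym (ℚ.*-identityʳ (g n)) ⟩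
    g n ℚ.* 1ℚ            ≡⟨ cong (g n ℚ.*_) (sym (proj₂ (proj₂ (reciprocal ε 0<ε)))) ⟩
    g n ℚ.* (e ℚ.* ε)     ≤⟨ ℚ.*-monoˡ-≤-nonNeg (g n) {{ℚ.nonNegative (ℚ.<⇒≤ (0<g n))}}
                               (ℚ.*-monoˡ-≤-nonNeg e {{ℚ.nonNegative (ℚ.<⇒≤ 0<e)}}
                                 (ℚ.p≤q⊔p (seq x n) ε)) ⟩
    g n ℚ.* (e ℚ.* u n)   ≡⟨ swap′ (g n) e (u n) ⟩
    (u n ℚ.* g n) ℚ.* e   ≡⟨ cong (ℚ._* e) (u*g≡1 n) ⟩
    1ℚ ℚ.* e              ≡⟨ ℚ.*-identityˡ e ⟩
    e ∎
    where
    swap′ : ∀ s t w → s ℚ.* (t ℚ.* w) ≡ (w ℚ.* s) ℚ.* t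
    swap′ = solve 3 (λ s t w → s :* (t :* w) := (w :* s) :* t) refl

  difference : ∀ m n → g m ℚ.- g n ≡ (u n ℚ.- u m) ℚ.* (g m ℚ.* g n)
  difference m n = begin-equality
    g m ℚ.- g n
      ≡⟨ cong₂ ℚ._-_ (sym (ℚ.*-identityʳ (g m))) (sym (ℚ.*-identityʳ (g n))) ⟩
    g m ℚ.* 1ℚ ℚ.- g n ℚ.* 1ℚ
      ≡⟨ cong₂ (λ s t → g m ℚ.* s ℚ.- g n ℚ.* t) (sym (u*g≡1 n)) (sym (u*g≡1 m)) ⟩
    g m ℚ.* (u n ℚ.* g n) ℚ.- g n ℚ.* (u m ℚ.* g m)
      ≡⟨ collect (g m) (g n) (u m) (u n) ⟩
    (u n ℚ.- u m) ℚ.* (g m ℚ.* g n) ∎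
    where
    collect : ∀ s t v w → s ℚ.* (w ℚ.* t) ℚ.- t ℚ.* (v ℚ.* s) ≡ (w ℚ.- v) ℚ.* (s ℚ.* t)
    collect = solve 4 (λ s t v w →
      s :* (w :* t) :- t :* (v :* s) := (w :- v) :* (s :* t)) refl

  g*g≤e*e : ∀ m n → ℚ.∣ g m ℚ.* g n ∣ ℚ.≤ e ℚ.* e
  g*g≤e*e m n = begin
    ℚ.∣ g m ℚ.* g n ∣  ≡⟨ ℚ.0≤p⇒∣p∣≡p (ℚ.<⇒≤ (ℚ-*-pos (0<g m) (0<g n))) ⟩
    g m ℚ.* g n        ≤⟨ ℚ.*-monoˡ-≤-nonNeg (g m) {{ℚ.nonNegative (ℚ.<⇒≤ (0<g m))}} (g≤e n) ⟩
    g m ℚ.* e          ≤⟨ ℚ.*-monoʳ-≤-nonNeg e {{ℚ.nonNegative (ℚ.<⇒≤ 0<e)}} (g≤e m) ⟩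
    e ℚ.* e ∎

  g-cauchy : Cauchy g
  -- A difference of two inverses is a difference of clamped terms times a factor bounded by the
  -- square of `e`.
  g-cauchy η 0<η with quotient η (e ℚ.* e) 0<η (ℚ-*-pos 0<e 0<e)
  ... | δ , 0<δ , δe²≡η with cauchy x δ 0<δ
  ... | M , hM = M ℕ.⊔ N , λ m n m≥ n≥ →
    subst₂ (λ d h → ℚ.∣ d ∣ ℚ.< h) (sym (difference m n)) δe²≡η
      (∣p*q∣< (u n ℚ.- u m) (g m ℚ.* g n) (ℚ-*-pos 0<e 0<e)
        (subst₂ (λ s t → ℚ.∣ s ℚ.- t ∣ ℚ.< δ)
          (sym (u≡x n (ℕ.m⊔n≤o⇒n≤o M N n≥))) (sym (u≡x m (ℕ.m⊔n≤o⇒n≤o M N m≥)))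
          (hM n m (ℕ.m⊔n≤o⇒m≤o M N n≥) (ℕ.m⊔n≤o⇒m≤o M N m≥)))
        (g*g≤e*e m n))

-- Multiplying a positive `- (z * y)` by `x` would make `- z` positive.
nonneg-*-pos⁻¹ : ∀ {x y z} → Pos x → (x * y) ≃ 1ℝ → NonNeg z → NonNeg (z * y)
nonneg-*-pos⁻¹ {x} {y} {z} 0<x (eventually N xy≡1) (nonneg ¬-z) = nonneg λ -zy →
  ¬-z (Pos-resp-≃ (eventually N cancel) (*-pos 0<x -zy))
  where
  regroup : ∀ s t w → s ℚ.* (ℚ.- (w ℚ.* t)) ≡ (s ℚ.* t) ℚ.* ℚ.- w
  regroup = solve 3 (λ s t w → s :* (:- (w :* t)) := (s :* t) :* :- w) refl
  cancel : ∀ n → N ℕ.≤ n → seq x n ℚ.* (ℚ.- (seq z n ℚ.* seq y n)) ≡ ℚ.- seq z n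
  cancel n n≥ = trans (regroup (seq x n) (seq y n) (seq z n))
    (trans (cong (ℚ._* ℚ.- seq z n) (xy≡1 n n≥)) (ℚ.*-identityˡ (ℚ.- seq z n)))

-- If `- (x * y)` exceeded `ε`, then `- x` would exceed ε/B for an upper bound `B` of `y`.
nonneg*pos : ∀ {x y} → NonNeg x → Pos y → NonNeg (x * y)
nonneg*pos {x} {y} (nonneg ¬-x) (pos η 0<η L hL) = nonneg λ (pos ε 0<ε M hM) →
  let B , 0<B , N , hN = bounded {seq y} (cauchy y)
      δ , 0<δ , δB≡ε   = quotient ε B 0<ε 0<B
  in ¬-x (pos δ 0<δ (L ℕ.⊔ (M ℕ.⊔ N)) λ n n≥ → ℚ.≰⇒> λ -x≤δ →
    let MN≤ = ℕ.m⊔n≤o⇒n≤o L (M ℕ.⊔ N) n≥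
        0<y = ℚ.<-trans 0<η (hL n (ℕ.m⊔n≤o⇒m≤o L (M ℕ.⊔ N) n≥))
        y≤B = subst (ℚ._≤ B) (ℚ.0≤p⇒∣p∣≡p (ℚ.<⇒≤ 0<y)) (hN n (ℕ.m⊔n≤o⇒n≤o M N MN≤))
    in ℚ.<-irrefl refl (ℚ.≤-<-trans (begin
      ℚ.- (seq x n ℚ.* seq y n)   ≡⟨ neg-* (seq x n) (seq y n) ⟩
      ℚ.- seq x n ℚ.* seq y n     ≤⟨ ℚ.*-monoʳ-≤-nonNeg (seq y n)
                                       {{ℚ.nonNegative (ℚ.<⇒≤ 0<y)}} -x≤δ ⟩
      δ ℚ.* seq y n               ≤⟨ ℚ.*-monoˡ-≤-nonNeg δ
                                       {{ℚ.nonNegative (ℚ.<⇒≤ 0<δ)}} y≤B ⟩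
      δ ℚ.* B                     ≡⟨ δB≡ε ⟩
      ε ∎) (hM n (ℕ.m⊔n≤o⇒m≤o M N MN≤))))
  where
  open ℚ.≤-Reasoning
  neg-* : ∀ s t → ℚ.- (s ℚ.* t) ≡ ℚ.- s ℚ.* t
  neg-* = solve 2 (λ s t → :- (s :* t) := :- s :* t) refl

Pos⇒NonNeg : ∀ {x} → Pos x → NonNeg x
Pos⇒NonNeg {x} 0<x = nonneg λ -x →
  Pos-irrefl (λ n → ℚ.+-inverseʳ (seq x n)) (+-pos 0<x -x)

NonNeg-resp-≃ : ∀ {x y} → x ≃ y → NonNeg x → NonNeg y
NonNeg-resp-≃ (eventually N h) (nonneg ¬-x) =
  nonneg λ -y → ¬-x (Pos-resp-≃ (eventually N λ n n≥ → cong ℚ.-_ (sym (h n n≥))) -y)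

+-null⇒≈ : ∀ {x y z} → x ≃ y + z → z ≈ 0ℝ → x ≈ y
+-null⇒≈ {x} {y} {z} (eventually M hM) z≈0 ε 0<ε =
  let N , hN = z≈0 ε 0<ε in M ℕ.⊔ N , λ n n≥ →
    subst (λ d → ℚ.∣ d ∣ ℚ.< ε)
      (trans (cancel (seq y n) (seq z n))
        (cong (ℚ._- seq y n) (sym (hM n (ℕ.m⊔n≤o⇒m≤o M N n≥)))))
      (hN n (ℕ.m⊔n≤o⇒n≤o M N n≥))
  where
  cancel : ∀ s t → t ℚ.- 0ℚ ≡ (s ℚ.+ t) ℚ.- s
  cancel = solve 2 (λ s t → t :- con 0ℚ := (s :+ t) :- s) refl

-- Polynomial identities for intersections and projections

:det :dot : ∀ {n} → (x₀ y₀ x₁ y₁ x₂ y₂ : Polynomial n) → Polynomial n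
:det x₀ y₀ x₁ y₁ x₂ y₂ = (x₁ :- x₀) :* (y₂ :- y₀) :- (y₁ :- y₀) :* (x₂ :- x₀)
:dot x₀ y₀ x₁ y₁ x₂ y₂ = (x₁ :- x₀) :* (x₂ :- x₀) :+ (y₁ :- y₀) :* (y₂ :- y₀)

-- The complement 1 - s/d equals t/d, so both bounds are instances of one sign rule.
unit-quotient : ∀ s t d i → Pos d → (d * i) ≃ 1ℝ → NonNeg s → NonNeg t →
  (∀ n → seq d n ≡ seq s n ℚ.+ seq t n) → 0ℝ ≤ s * i × s * i ≤ 1ℝ
unit-quotient s t d i 0<d di≃1@(eventually N di≡1) 0≤s 0≤t d≡s+t =
    NonNeg⇒≤ {0ℝ} {s * i} (NonNeg-resp {s * i} {s * i - 0ℝ} (λ n → minus-0 (seq s n ℚ.* seq i n))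
      (nonneg-*-pos⁻¹ {d} {i} {s} 0<d di≃1 0≤s))
  , NonNeg⇒≤ {s * i} {1ℝ} (NonNeg-resp-≃ {t * i} {1ℝ - s * i} (eventually N complement)
      (nonneg-*-pos⁻¹ {d} {i} {t} 0<d di≃1 0≤t))
  where
  minus-0 : ∀ s → s ≡ s ℚ.- 0ℚ
  minus-0 = solve 1 (λ s → s := s :- con 0ℚ) refl
  expand : ∀ s t i → t ℚ.* i ≡ (s ℚ.+ t) ℚ.* i ℚ.- s ℚ.* i
  expand = solve 3 (λ s t i → t :* i := (s :+ t) :* i :- s :* i) refl
  complement : ∀ n → N ℕ.≤ n → seq (t * i) n ≡ 1ℚ ℚ.- seq s n ℚ.* seq i n
  complement n n≥ = trans (expand (seq s n) (seq t n) (seq i n))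
    (cong (ℚ._- (seq s n ℚ.* seq i n))
      (trans (cong (ℚ._* seq i n) (sym (d≡s+t n))) (di≡1 n n≥)))

cross-product dot-product : (x₀ y₀ x₁ y₁ x₂ y₂ : ℚ) → ℚ
cross-product x₀ y₀ x₁ y₁ x₂ y₂ =
  (x₁ ℚ.- x₀) ℚ.* (y₂ ℚ.- y₀) ℚ.- (y₁ ℚ.- y₀) ℚ.* (x₂ ℚ.- x₀)
dot-product x₀ y₀ x₁ y₁ x₂ y₂ =
  (x₁ ℚ.- x₀) ℚ.* (x₂ ℚ.- x₀) ℚ.+ (y₁ ℚ.- y₀) ℚ.* (y₂ ℚ.- y₀)

-- Brings the hypothesis `d ≡ 1` into a polynomial identity: the solver proves the identity up to a
-- multiple of 1 - d.
absorb : ∀ s t d → d ≡ 1ℚ → s ℚ.+ t ℚ.* (1ℚ ℚ.- d) ≡ s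
absorb s t d d≡1 = trans (cong (λ e → s ℚ.+ t ℚ.* (1ℚ ℚ.- e)) d≡1) (vanish s t)
  where
  vanish : ∀ s t → s ℚ.+ t ℚ.* (1ℚ ℚ.- 1ℚ) ≡ s
  vanish = solve 2 (λ s t → s :+ t :* (con 1ℚ :- con 1ℚ) := s) refl

-- Cramer's rule for the intersection of the lines `x y` and `u v`; `i` is the inverse of the common
-- denominator of the two parameters.
meet-x : ∀ x x′ y y′ u u′ v v′ i →
  (cross-product u u′ v v′ x x′ ℚ.+ cross-product v v′ u u′ y y′) ℚ.* i ≡ 1ℚ →
  x ℚ.+ (cross-product u u′ v v′ x x′ ℚ.* i) ℚ.* (y ℚ.- x) ≡
  u ℚ.+ (cross-product y y′ x x′ u u′ ℚ.* i) ℚ.* (v ℚ.- u)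
meet-x x x′ y y′ u u′ v v′ i d≡1 = trans
  (solve 9 (λ x x′ y y′ u u′ v v′ i →
    x :+ (:det u u′ v v′ x x′ :* i) :* (y :- x) :=
    (u :+ (:det y y′ x x′ u u′ :* i) :* (v :- u))
      :+ (x :- u) :* (con 1ℚ :- (:det u u′ v v′ x x′ :+ :det v v′ u u′ y y′) :* i)) refl
    x x′ y y′ u u′ v v′ i)
  (absorb _ (x ℚ.- u) _ d≡1)

meet-y : ∀ x x′ y y′ u u′ v v′ i →
  (cross-product u u′ v v′ x x′ ℚ.+ cross-product v v′ u u′ y y′) ℚ.* i ≡ 1ℚ →
  x′ ℚ.+ (cross-product u u′ v v′ x x′ ℚ.* i) ℚ.* (y′ ℚ.- x′) ≡
  u′ ℚ.+ (cross-product y y′ x x′ u u′ ℚ.* i) ℚ.* (v′ ℚ.- u′)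
meet-y x x′ y y′ u u′ v v′ i d≡1 = trans
  (solve 9 (λ x x′ y y′ u u′ v v′ i →
    x′ :+ (:det u u′ v v′ x x′ :* i) :* (y′ :- x′) :=
    (u′ :+ (:det y y′ x x′ u u′ :* i) :* (v′ :- u′))
      :+ (x′ :- u′) :* (con 1ℚ :- (:det u u′ v v′ x x′ :+ :det v v′ u u′ y y′) :* i)) refl
    x x′ y y′ u u′ v v′ i)
  (absorb _ (x′ ℚ.- u′) _ d≡1)

-- Splits `w` into its orthogonal projection to the line `u v` and a perpendicular part, which is a
-- multiple of the determinant and so null for collinear points.
foot-x : ∀ u u′ v v′ w w′ i → dot-product u u′ v v′ v v′ ℚ.* i ≡ 1ℚ →
  w ≡ (u ℚ.+ (dot-product u u′ v v′ w w′ ℚ.* i) ℚ.* (v ℚ.- u))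
        ℚ.+ ((u′ ℚ.- v′) ℚ.* i) ℚ.* cross-product u u′ v v′ w w′
foot-x u u′ v v′ w w′ i d≡1 = trans
  (solve 7 (λ u u′ v v′ w w′ i →
    w := ((u :+ (:dot u u′ v v′ w w′ :* i) :* (v :- u)) :+ ((u′ :- v′) :* i) :* :det u u′ v v′ w w′)
           :+ (w :- u) :* (con 1ℚ :- :dot u u′ v v′ v v′ :* i)) refl
    u u′ v v′ w w′ i)
  (absorb _ (w ℚ.- u) _ d≡1)

foot-y : ∀ u u′ v v′ w w′ i → dot-product u u′ v v′ v v′ ℚ.* i ≡ 1ℚ →
  w′ ≡ (u′ ℚ.+ (dot-product u u′ v v′ w w′ ℚ.* i) ℚ.* (v′ ℚ.- u′))
         ℚ.+ ((v ℚ.- u) ℚ.* i) ℚ.* cross-product u u′ v v′ w w′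
foot-y u u′ v v′ w w′ i d≡1 = trans
  (solve 7 (λ u u′ v v′ w w′ i →
    w′ := ((u′ :+ (:dot u u′ v v′ w w′ :* i) :* (v′ :- u′)) :+ ((v :- u) :* i) :* :det u u′ v v′ w w′)
            :+ (w′ :- u′) :* (con 1ℚ :- :dot u u′ v v′ v v′ :* i)) refl
    u u′ v v′ w w′ i)
  (absorb _ (w′ ℚ.- u′) _ d≡1)

≈-refl : ∀ x → x ≈ x
≈-refl x = ≃⇒≈ {x} {x} (pointwise λ _ → refl)

square-nonneg : ∀ x → NonNeg (x * x)
square-nonneg x = nonneg λ (pos ε 0<ε N h) →
  ℚ.<-irrefl refl (ℚ.<-≤-trans (ℚ.<-trans 0<ε (h N ℕ.≤-refl))
    (ℚ.neg-antimono-≤ (square≥0 (seq x N))))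
  where
  square≥0 : ∀ s → 0ℚ ℚ.≤ s ℚ.* s
  square≥0 s = subst (0ℚ ℚ.≤_) (trans (ℚ.∣p*q∣≡∣p∣*∣q∣ s s) (abs² (ℚ.∣p∣≡p∨∣p∣≡-p s)))
    (ℚ.0≤∣p∣ (s ℚ.* s))
    where
    abs² : ℚ.∣ s ∣ ≡ s ⊎ ℚ.∣ s ∣ ≡ ℚ.- s → ℚ.∣ s ∣ ℚ.* ℚ.∣ s ∣ ≡ s ℚ.* s
    abs² (inj₁ ≡s) = cong₂ ℚ._*_ ≡s ≡s
    abs² (inj₂ ≡-s) = trans (cong₂ ℚ._*_ ≡-s ≡-s)
      (solve 1 (λ s → (:- s) :* (:- s) := s :* s) refl s)

-- If the square is not positive then neither `x` nor `- x` is, which makes `x` null.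
≉0⇒¬¬Pos-square : ∀ x → ¬ x ≈ 0ℝ → ¬ ¬ Pos (x * x)
≉0⇒¬¬Pos-square x x≉0 ¬sq = x≉0 (NonNeg-antisym {x}
  (nonneg λ -x → ¬sq (Pos-resp {(- x) * (- x)} {x * x} (λ n → neg² (seq x n))
    (*-pos { - x} { - x} -x -x)))
  (¬Pos⇒NonNeg-neg {x} (λ p → ¬sq (*-pos {x} {x} p p))))
  where
  neg² : ∀ s → (ℚ.- s) ℚ.* (ℚ.- s) ≡ s ℚ.* s
  neg² = solve 1 (λ s → (:- s) :* (:- s) := s :* s) refl

x-y≈0⇒x≈y : ∀ x y → y - x ≈ 0ℝ → x ≈ y
x-y≈0⇒x≈y x y h = +-null⇒≈ {x} {y} {(- 1ℝ) * (y - x)}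
  (pointwise λ n → recover (seq x n) (seq y n)) (*-zeroʳ-≈ (- 1ℝ) {y - x} h)
  where
  recover : ∀ s t → s ≡ t ℚ.+ (ℚ.- 1ℚ) ℚ.* (t ℚ.- s)
  recover = solve 2 (λ s t → s := t :+ (:- con 1ℚ) :* (t :- s)) refl

-- Oriented areas, dot products and segments in the plane

-- Abstract because comparing unfolded real expressions makes Agda compare
-- their Cauchy proofs, which is infeasible.
abstract

  det : Point → Point → Point → ℝ
  det (x₀ , y₀) (x₁ , y₁) (x₂ , y₂) = (x₁ - x₀) * (y₂ - y₀) - (y₁ - y₀) * (x₂ - x₀)

  dot : Point → Point → Point → ℝ
  dot (x₀ , y₀) (x₁ , y₁) (x₂ , y₂) = (x₁ - x₀) * (x₂ - x₀) + (y₁ - y₀) * (y₂ - y₀)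

  det-cyc : ∀ u v w → Pos (det u v w) → Pos (det v w u)
  det-cyc (u , u′) (v , v′) (w , w′) = Pos-resp λ n →
    solve 6 (λ u u′ v v′ w w′ → :det u u′ v v′ w w′ := :det v v′ w w′ u u′) refl
      (seq u n) (seq u′ n) (seq v n) (seq v′ n) (seq w n) (seq w′ n)

  det-asym : ∀ u v w → Pos (det u v w) → ¬ Pos (det v u w)
  det-asym (u , u′) (v , v′) (w , w′) p p′ = Pos-irrefl (λ n →
    solve 6 (λ u u′ v v′ w w′ → :det u u′ v v′ w w′ :+ :det v v′ u u′ w w′ := con 0ℚ) refl
      (seq u n) (seq u′ n) (seq v n) (seq v′ n) (seq w n) (seq w′ n)) (+-pos p p′)

  det-flip : ∀ u v w → ¬ Pos (det v u w) → NonNeg (det u v w)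
  det-flip (u , u′) (v , v′) (w , w′) ¬p = NonNeg-resp (λ n →
    solve 6 (λ u u′ v v′ w w′ → :- :det v v′ u u′ w w′ := :det u u′ v v′ w w′) refl
      (seq u n) (seq u′ n) (seq v n) (seq v′ n) (seq w n) (seq w′ n)) (¬Pos⇒NonNeg-neg ¬p)

  -- The oriented areas of the three triangles with apex `x` sum to that of `u v w`.
  det-sum : ∀ u v w x → Pos (det u v x) → Pos (det v w x) → Pos (det w u x) → Pos (det u v w)
  det-sum (u , u′) (v , v′) (w , w′) (x , x′) p p′ p″ = Pos-resp (λ n →
    solve 8 (λ u u′ v v′ w w′ x x′ →
        :det u u′ v v′ x x′ :+ (:det v v′ w w′ x x′ :+ :det w w′ u u′ x x′) := :det u u′ v v′ w w′) refl
      (seq u n) (seq u′ n) (seq v n) (seq v′ n) (seq w n) (seq w′ n) (seq x n) (seq x′ n))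
    (+-pos p (+-pos p′ p″))

  -- By the same identity the three areas at `x` have a positive sum, so they are not all
  -- nonpositive.
  outside-all : ∀ u v w x → Pos (det u v w) →
    NonNeg (det v u x) → NonNeg (det w v x) → ¬ NonNeg (det u w x)
  outside-all (u , u′) (v , v′) (w , w′) (x , x′) p n₁ n₂ n₃ = Pos-irrefl (λ n →
    solve 8 (λ u u′ v v′ w w′ x x′ →
        ((:det u u′ v v′ w w′ :+ :det v v′ u u′ x x′) :+ :det w w′ v v′ x x′) :+ :det u u′ w w′ x x′ := con 0ℚ) refl
      (seq u n) (seq u′ n) (seq v n) (seq v′ n) (seq w n) (seq w′ n) (seq x n) (seq x′ n))
    (pos+nonneg (pos+nonneg (pos+nonneg p n₁) n₂) n₃)

  -- The two Grassmann–Plücker relations used to follow the line xy out of the triangle uvw.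
  exit-left : ∀ u v w x y → Pos (det u v w) → Pos (det u v x) → Pos (det v w x) →
    NonNeg (det v u y) → Pos (det y x v) → ¬ NonNeg (det v w y)
  exit-left (u , u′) (v , v′) (w , w′) (x , x′) (y , y′) uvw uvx vwx vuy yxv vwy =
    Pos-irrefl (λ n →
      solve 10 (λ u u′ v v′ w w′ x x′ y y′ →
          (:det u u′ v v′ w w′ :* :det y y′ x x′ v v′ :+ :det v v′ w w′ y y′ :* :det u u′ v v′ x x′)
            :+ :det v v′ u u′ y y′ :* :det v v′ w w′ x x′ := con 0ℚ) refl
        (seq u n) (seq u′ n) (seq v n) (seq v′ n) (seq w n) (seq w′ n)
        (seq x n) (seq x′ n) (seq y n) (seq y′ n))
    (pos+nonneg (pos+nonneg (*-pos uvw yxv) (nonneg*pos vwy uvx)) (nonneg*pos vuy vwx))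

  exit-right : ∀ u v w x y → Pos (det u v w) → Pos (det u v x) → Pos (det w u x) →
    NonNeg (det v u y) → Pos (det x y u) → ¬ NonNeg (det w u y)
  exit-right (u , u′) (v , v′) (w , w′) (x , x′) (y , y′) uvw uvx wux vuy xyu wuy =
    Pos-irrefl (λ n →
      solve 10 (λ u u′ v v′ w w′ x x′ y y′ →
          (:det u u′ v v′ w w′ :* :det x x′ y y′ u u′ :+ :det w w′ u u′ y y′ :* :det u u′ v v′ x x′)
            :+ :det v v′ u u′ y y′ :* :det w w′ u u′ x x′ := con 0ℚ) refl
        (seq u n) (seq u′ n) (seq v n) (seq v′ n) (seq w n) (seq w′ n)
        (seq x n) (seq x′ n) (seq y n) (seq y′ n))
    (pos+nonneg (pos+nonneg (*-pos uvw xyu) (nonneg*pos wuy uvx)) (nonneg*pos vuy wux))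

  -- Both sums of four areas equal the signed area of the quadrilateral 1234.
  no-opposite-areas : ∀ x y p₁ p₂ p₃ p₄ →
    Pos (det x p₁ p₂) → Pos (det x p₂ p₃) → Pos (det x p₃ p₄) → Pos (det x p₄ p₁) →
    Pos (det y p₂ p₁) → Pos (det y p₃ p₂) → Pos (det y p₄ p₃) → ¬ Pos (det y p₁ p₄)
  no-opposite-areas (x , x′) (y , y′) (s , s′) (t , t′) (u , u′) (v , v′) h₁ h₂ h₃ h₄ k₁ k₂ k₃ k₄ =
    Pos-irrefl (λ n →
      solve 12 (λ x x′ y y′ s s′ t t′ u u′ v v′ →
          ((:det x x′ s s′ t t′ :+ :det x x′ t t′ u u′) :+ (:det x x′ u u′ v v′ :+ :det x x′ v v′ s s′))
            :+ ((:det y y′ t t′ s s′ :+ :det y y′ u u′ t t′) :+ (:det y y′ v v′ u u′ :+ :det y y′ s s′ v v′))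
            := con 0ℚ) refl
        (seq x n) (seq x′ n) (seq y n) (seq y′ n) (seq s n) (seq s′ n) (seq t n) (seq t′ n)
        (seq u n) (seq u′ n) (seq v n) (seq v′ n))
    (+-pos (+-pos (+-pos h₁ h₂) (+-pos h₃ h₄)) (+-pos (+-pos k₁ k₂) (+-pos k₃ k₄)))

  -- By the two expressions for `d`, each parameter is the quotient of a nonnegative summand by the
  -- sum of two; the strict hypothesis makes `d` invertible.
  segments-meet : ∀ x y u v → Pos (det u v x) → NonNeg (det v u y) →
    NonNeg (det x y v) → NonNeg (det y x u) → ∃[ p ] p ∈ segment x y × p ∈ segment u v
  segments-meet x@(x₁ , x₂) y@(y₁ , y₂) u@(u₁ , u₂) v@(v₁ , v₂) uvx vuy xyv yxu =
    along (inverse 0<d)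
    where
    d : ℝ
    d = det u v x + det v u y

    0<d : Pos d
    0<d = pos+nonneg {det u v x} {det v u y} uvx vuy

    d-alt : ∀ n → seq d n ≡ seq (det y x u + det x y v) n
    d-alt n = solve 8 (λ x x′ y y′ u u′ v v′ →
        :det u u′ v v′ x x′ :+ :det v v′ u u′ y y′ := :det y y′ x x′ u u′ :+ :det x x′ y y′ v v′) refl
      (seq x₁ n) (seq x₂ n) (seq y₁ n) (seq y₂ n) (seq u₁ n) (seq u₂ n) (seq v₁ n) (seq v₂ n)

    along : ∃[ i ] (d * i) ≃ 1ℝ → ∃[ p ] p ∈ segment x y × p ∈ segment u v
    along (i , di≃1@(eventually N di≡1)) =
        (x₁ + s * (y₁ - x₁) , x₂ + s * (y₂ - x₂))
      , ((s , s-unit) , ≈-refl (x₁ + s * (y₁ - x₁)) , ≈-refl (x₂ + s * (y₂ - x₂)))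
      , ((t , t-unit) , ≃⇒≈ {x₁ + s * (y₁ - x₁)} {u₁ + t * (v₁ - u₁)} on-x
                     , ≃⇒≈ {x₂ + s * (y₂ - x₂)} {u₂ + t * (v₂ - u₂)} on-y)
      where
      s t : ℝ
      s = det u v x * i
      t = det y x u * i
      s-unit : 0ℝ ≤ s × s ≤ 1ℝ
      s-unit = unit-quotient (det u v x) (det v u y) d i 0<d di≃1
        (Pos⇒NonNeg {det u v x} uvx) vuy (λ _ → refl)
      t-unit : 0ℝ ≤ t × t ≤ 1ℝ
      t-unit = unit-quotient (det y x u) (det x y v) d i 0<d di≃1 yxu xyv d-alt
      on-x : (x₁ + s * (y₁ - x₁)) ≃ (u₁ + t * (v₁ - u₁))
      on-x = eventually N λ n n≥ → meet-x (seq x₁ n) (seq x₂ n) (seq y₁ n) (seq y₂ n)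
        (seq u₁ n) (seq u₂ n) (seq v₁ n) (seq v₂ n) (seq i n) (di≡1 n n≥)
      on-y : (x₂ + s * (y₂ - x₂)) ≃ (u₂ + t * (v₂ - u₂))
      on-y = eventually N λ n n≥ → meet-y (seq x₁ n) (seq x₂ n) (seq y₁ n) (seq y₂ n)
        (seq u₁ n) (seq u₂ n) (seq v₁ n) (seq v₂ n) (seq i n) (di≡1 n n≥)

  -- The two dot products sum to the squared length, so the projection of `w` has its parameter in
  -- the unit interval; collinearity identifies `w` with its projection.
  on-segment : ∀ u v w → Pos (dot u v v) → NonNeg (dot u v w) → NonNeg (dot v u w) →
    det u v w ≈ 0ℝ → w ∈ segment u v
  on-segment u@(u₁ , u₂) v@(v₁ , v₂) w@(w₁ , w₂) 0<uvv 0≤uvw 0≤vuw collinear =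
    foot (inverse 0<uvv)
    where
    split : ∀ n → seq (dot u v v) n ≡ seq (dot u v w + dot v u w) n
    split n = solve 6 (λ u u′ v v′ w w′ →
        :dot u u′ v v′ v v′ := :dot u u′ v v′ w w′ :+ :dot v v′ u u′ w w′) refl
      (seq u₁ n) (seq u₂ n) (seq v₁ n) (seq v₂ n) (seq w₁ n) (seq w₂ n)

    foot : ∃[ i ] (dot u v v * i) ≃ 1ℝ → w ∈ segment u v
    foot (i , di≃1@(eventually N di≡1)) = (t , t-unit)
      , +-null⇒≈ {w₁} {u₁ + t * (v₁ - u₁)} {((u₂ - v₂) * i) * det u v w} on-x
           (*-zeroʳ-≈ ((u₂ - v₂) * i) {det u v w} collinear)
      , +-null⇒≈ {w₂} {u₂ + t * (v₂ - u₂)} {((v₁ - u₁) * i) * det u v w} on-y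
           (*-zeroʳ-≈ ((v₁ - u₁) * i) {det u v w} collinear)
      where
      t : ℝ
      t = dot u v w * i
      t-unit : 0ℝ ≤ t × t ≤ 1ℝ
      t-unit = unit-quotient (dot u v w) (dot v u w) (dot u v v) i 0<uvv di≃1 0≤uvw 0≤vuw split
      on-x : w₁ ≃ ((u₁ + t * (v₁ - u₁)) + ((u₂ - v₂) * i) * det u v w)
      on-x = eventually N λ n n≥ → foot-x (seq u₁ n) (seq u₂ n) (seq v₁ n) (seq v₂ n)
        (seq w₁ n) (seq w₂ n) (seq i n) (di≡1 n n≥)
      on-y : w₂ ≃ ((u₂ + t * (v₂ - u₂)) + ((v₁ - u₁) * i) * det u v w)
      on-y = eventually N λ n n≥ → foot-y (seq u₁ n) (seq u₂ n) (seq v₁ n) (seq v₂ n)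
        (seq w₁ n) (seq w₂ n) (seq i n) (di≡1 n n≥)

  -- The dot product is the squared distance, positive as soon as one coordinate difference has a
  -- positive square.
  distinct⇒¬¬Pos : ∀ u v → ¬ u ≈ₚ v → ¬ ¬ Pos (dot u v v)
  distinct⇒¬¬Pos u@(u₁ , u₂) v@(v₁ , v₂) u≉v ¬p =
    ≉0⇒¬¬Pos-square dx (λ dx≈0 → ≉0⇒¬¬Pos-square dy (dy≉0 dx≈0) (λ p → ¬p (from-y p)))
      (λ p → ¬p (from-x p))
    where
    dx dy : ℝ
    dx = v₁ - u₁
    dy = v₂ - u₂
    dy≉0 : dx ≈ 0ℝ → ¬ dy ≈ 0ℝ
    dy≉0 dx≈0 dy≈0 = u≉v (x-y≈0⇒x≈y u₁ v₁ dx≈0 , x-y≈0⇒x≈y u₂ v₂ dy≈0)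
    from-x : Pos (dx * dx) → Pos (dot u v v)
    from-x p = Pos-resp {dx * dx + dy * dy} {dot u v v} (λ _ → refl)
      (pos+nonneg {dx * dx} {dy * dy} p (square-nonneg dy))
    from-y : Pos (dy * dy) → Pos (dot u v v)
    from-y p = Pos-resp {dy * dy + dx * dx} {dot u v v}
      (λ n → ℚ.+-comm (seq (dy * dy) n) (seq (dx * dx) n))
      (pos+nonneg {dy * dy} {dx * dx} p (square-nonneg dx))

  dot-complement : ∀ u v w → Pos (dot u v v) → ¬ Pos (dot u v w) → Pos (dot v u w)
  dot-complement u@(u₁ , u₂) v@(v₁ , v₂) w@(w₁ , w₂) uvv ¬uvw =
    Pos-resp {dot u v v + - dot u v w} {dot v u w} (λ n →
      solve 6 (λ u u′ v v′ w w′ →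
        :dot u u′ v v′ v v′ :+ :- :dot u u′ v v′ w w′ := :dot v v′ u u′ w w′) refl
        (seq u₁ n) (seq u₂ n) (seq v₁ n) (seq v₂ n) (seq w₁ n) (seq w₂ n))
    (pos+nonneg {dot u v v} { - dot u v w} uvv (¬Pos⇒NonNeg-neg {dot u v w} ¬uvw))

  det-null : ∀ u v w → ¬ Pos (det u v w) → ¬ Pos (det v u w) → det u v w ≈ 0ℝ
  det-null u v w ¬p ¬p′ =
    NonNeg-antisym {det u v w} (det-flip u v w ¬p′) (¬Pos⇒NonNeg-neg {det u v w} ¬p)

  dot-sym : ∀ u v w → Pos (dot u v w) → Pos (dot u w v)
  dot-sym u@(u₁ , u₂) v@(v₁ , v₂) w@(w₁ , w₂) = Pos-resp {dot u v w} {dot u w v} (λ n →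
    solve 6 (λ u u′ v v′ w w′ → :dot u u′ v v′ w w′ := :dot u u′ w w′ v v′) refl
      (seq u₁ n) (seq u₂ n) (seq v₁ n) (seq v₂ n) (seq w₁ n) (seq w₂ n))

  -- A point at which the dot product is not positive lies between the other
  -- two; if there is none, any point lies between the other two.
  collinear⇒between : ∀ u v w → ¬ u ≈ₚ v → ¬ u ≈ₚ w → ¬ v ≈ₚ w →
    ¬ Pos (det u v w) → ¬ Pos (det v u w) →
    ¬ ¬ (w ∈ segment u v ⊎ v ∈ segment u w ⊎ u ∈ segment v w)
  collinear⇒between u v w u≉v u≉w v≉w ¬uvw ¬vuw none =
    distinct⇒¬¬Pos u v u≉v λ uv → distinct⇒¬¬Pos u w u≉w λ uw → distinct⇒¬¬Pos v w v≉w λ vw →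
    ¬¬-excluded-middle λ u? → ¬¬-excluded-middle λ v? → none (locate uv uw vw u? v?)
    where
    locate : Pos (dot u v v) → Pos (dot u w w) → Pos (dot v w w) →
             Dec (Pos (dot u v w)) → Dec (Pos (dot v u w)) →
             w ∈ segment u v ⊎ v ∈ segment u w ⊎ u ∈ segment v w
    locate uv uw vw (no ¬u) _ = inj₂ (inj₂ (on-segment v w u vw
      (Pos⇒NonNeg {dot v w u} (dot-sym v u w (dot-complement u v w uv ¬u)))
      (Pos⇒NonNeg {dot w v u} (dot-sym w u v (dot-complement u w v uw (λ p → ¬u (dot-sym u w v p)))))
      (det-null v w u (λ p → ¬uvw (det-cyc w u v (det-cyc v w u p)))
                      (λ p → ¬vuw (det-cyc w v u p)))))
    locate uv uw vw (yes 0<u) (no ¬v) = inj₂ (inj₁ (on-segment u w v uw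
      (Pos⇒NonNeg {dot u w v} (dot-sym u v w 0<u))
      (Pos⇒NonNeg {dot w u v} (dot-sym w v u (dot-complement v w u vw (λ p → ¬v (dot-sym v w u p)))))
      (det-null u w v (λ p → ¬vuw (det-cyc w v u (det-cyc u w v p)))
                      (λ p → ¬uvw (det-cyc w u v p)))))
    locate uv uw vw (yes 0<u) (yes 0<v) = inj₁ (on-segment u v w uv
      (Pos⇒NonNeg {dot u v w} 0<u) (Pos⇒NonNeg {dot v u w} 0<v) (det-null u v w ¬uvw ¬vuw))

  -- The regions beyond sides 34 and 12, cut out by the lines 23 and 41, lie on
  -- opposite sides of the intersection point of these two lines.
  no-opposite-wedges : ∀ x y p₁ p₂ p₃ p₄ →
    Pos (det p₂ p₃ p₄) → Pos (det p₁ p₃ p₄) → Pos (det p₁ p₂ p₄) → Pos (det p₁ p₂ p₃) →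
    Pos (det p₃ p₂ x) → Pos (det p₁ p₄ x) → Pos (det p₄ p₃ x) →
    Pos (det p₃ p₂ y) → Pos (det p₁ p₄ y) → ¬ Pos (det p₂ p₁ y)
  no-opposite-wedges x@(x₁ , x₂) y@(y₁ , y₂) s@(s₁ , s₂) t@(t₁ , t₂) u@(u₁ , u₂) v@(v₁ , v₂)
    d₁ d₂ d₃ d₄ f g h f′ g′ k = Pos-irrefl {P * det t s y + Q * det v u x} (λ n →
      trans (cong₂ (λ p p′ → p ℚ.* seq (det t s y) n ℚ.+ p′ ℚ.* seq (det v u x) n) (first n) (second n))
        (vanish (seq (det s t u - det t u v) n) (seq (det s u v - det s t v) n)
          (seq (det v u x) n) (seq (det t s y) n) (areas n)))
    (+-pos {P * det t s y} {Q * det v u x}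
      (*-pos {P} {det t s y} 0<P k) (*-pos {Q} {det v u x} 0<Q h))
    where
    -- With 1, 2, 3, 4 for s, t, u, v: P = ([123] − [234]) [43x], as [43x] is an affine
    -- combination of [32x], [14x] and 1; likewise Q = ([134] − [124]) [21y].  The two
    -- bracketed factors are opposite.
    P Q : ℝ
    P = det t u v * det s u v + det s u v * det u t x + det t u v * det s v x
    Q = det s t v * det s t u + det s t v * det u t y + det s t u * det s v y

    0<P : Pos P
    0<P = +-pos {det t u v * det s u v + det s u v * det u t x} {det t u v * det s v x}
      (+-pos {det t u v * det s u v} {det s u v * det u t x}
        (*-pos {det t u v} {det s u v} d₁ d₂) (*-pos {det s u v} {det u t x} d₂ f))
      (*-pos {det t u v} {det s v x} d₁ g)

    0<Q : Pos Q
    0<Q = +-pos {det s t v * det s t u + det s t v * det u t y} {det s t u * det s v y}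
      (+-pos {det s t v * det s t u} {det s t v * det u t y}
        (*-pos {det s t v} {det s t u} d₃ d₄) (*-pos {det s t v} {det u t y} d₃ f′))
      (*-pos {det s t u} {det s v y} d₄ g′)

    first : ∀ n → seq P n ≡ seq ((det s t u - det t u v) * det v u x) n
    first n = solve 10 (λ x x′ s s′ t t′ u u′ v v′ →
        :det t t′ u u′ v v′ :* :det s s′ u u′ v v′ :+ :det s s′ u u′ v v′ :* :det u u′ t t′ x x′
          :+ :det t t′ u u′ v v′ :* :det s s′ v v′ x x′
        := (:det s s′ t t′ u u′ :- :det t t′ u u′ v v′) :* :det v v′ u u′ x x′) refl
      (seq x₁ n) (seq x₂ n) (seq s₁ n) (seq s₂ n) (seq t₁ n) (seq t₂ n)
      (seq u₁ n) (seq u₂ n) (seq v₁ n) (seq v₂ n)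

    second : ∀ n → seq Q n ≡ seq ((det s u v - det s t v) * det t s y) n
    second n = solve 10 (λ y y′ s s′ t t′ u u′ v v′ →
        :det s s′ t t′ v v′ :* :det s s′ t t′ u u′ :+ :det s s′ t t′ v v′ :* :det u u′ t t′ y y′
          :+ :det s s′ t t′ u u′ :* :det s s′ v v′ y y′
        := (:det s s′ u u′ v v′ :- :det s s′ t t′ v v′) :* :det t t′ s s′ y y′) refl
      (seq y₁ n) (seq y₂ n) (seq s₁ n) (seq s₂ n) (seq t₁ n) (seq t₂ n)
      (seq u₁ n) (seq u₂ n) (seq v₁ n) (seq v₂ n)

    areas : ∀ n → seq (det s t u - det t u v) n ≡ seq (- (det s u v - det s t v)) n
    areas n = solve 8 (λ s s′ t t′ u u′ v v′ →
        :det s s′ t t′ u u′ :- :det t t′ u u′ v v′ := :- (:det s s′ u u′ v v′ :- :det s s′ t t′ v v′)) refl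
      (seq s₁ n) (seq s₂ n) (seq t₁ n) (seq t₂ n) (seq u₁ n) (seq u₂ n) (seq v₁ n) (seq v₂ n)

    vanish : ∀ e e′ h k → e ≡ ℚ.- e′ → (e ℚ.* h) ℚ.* k ℚ.+ (e′ ℚ.* k) ℚ.* h ≡ 0ℚ
    vanish e e′ h k refl = solve 3 (λ e′ h k →
      ((:- e′) :* h) :* k :+ (e′ :* k) :* h := con 0ℚ) refl e′ h k

-- Far sides of a quadrilateral

-- The configuration of a quadrilateral p₁p₂p₃p₄ seen from z when p₃ and p₄
-- lie in the triangle zp₁p₂ of positive orientation.
record Far (z p₁ p₂ p₃ p₄ : Point) : Set where
  constructor far
  field
    124>0 : Pos (det p₁ p₂ p₄)
    123>0 : Pos (det p₁ p₂ p₃)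
    32z>0 : Pos (det p₃ p₂ z)
    14z>0 : Pos (det p₁ p₄ z)
    43z>0 : Pos (det p₄ p₃ z)

no-opposite-far : ∀ {x y p₁ p₂ p₃ p₄} → Far x p₁ p₂ p₃ p₄ → ¬ Far y p₃ p₄ p₁ p₂
no-opposite-far {x} {y} {p₁} {p₂} {p₃} {p₄} F G =
  no-opposite-wedges x y p₁ p₂ p₃ p₄
    (det-cyc p₄ p₂ p₃ (det-cyc p₃ p₄ p₂ G.124>0)) (det-cyc p₄ p₁ p₃ (det-cyc p₃ p₄ p₁ G.123>0))
    F.124>0 F.123>0 F.32z>0 F.14z>0 F.43z>0 G.14z>0 G.32z>0 G.43z>0
  where
  module F = Far F
  module G = Far G

-- Turns a decision into a label for the pigeonhole principle.
bit : ∀ {P : Set} → Dec P → Fin 2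
bit (yes _) = 0F
bit (no _)  = 1F

bit-agree : ∀ {P Q : Set} (p? : Dec P) (q? : Dec Q) → bit p? ≡ bit q? → P × Q ⊎ ¬ P × ¬ Q
bit-agree (yes p) (yes p′) refl = inj₁ (p , p′)
bit-agree (no ¬p) (no ¬p′) refl = inj₂ (¬p , ¬p′)

next⁴ : ∀ i → next (next (next (next i))) ≡ i
next⁴ 0F = refl
next⁴ 1F = refl
next⁴ 2F = refl
next⁴ 3F = refl

-- Orientation and containment in a planar straight-line drawing

module Frame {G : Graph} (drawing : Drawing G)
  (planar : Planar drawing) (straight : StraightLine drawing) where

  open Graph G
  open Drawing drawing
  open Planar planar

  record CCW (u v w : Vertex) : Set where
    constructor ccw
    field area : Pos (det (point u) (point v) (point w))

  open CCW public

  private variable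
    u v w x y z : Vertex

  rot : CCW u v w → CCW v w u
  rot {u} {v} {w} (ccw p) = ccw (det-cyc (point u) (point v) (point w) p)

  asym : CCW u v w → ¬ CCW v u w
  asym {u} {v} {w} (ccw p) (ccw p′) = det-asym (point u) (point v) (point w) p p′

  asym′ : CCW u v w → ¬ CCW u w v
  asym′ h k = asym (rot h) (rot k)

  asym″ : CCW u v w → ¬ CCW w v u
  asym″ h k = asym h (rot k)

  CCW⇒≢ : CCW u v w → w ≢ u × w ≢ v
  CCW⇒≢ h = (λ { refl → asym (rot (rot h)) (rot (rot h)) }) , (λ { refl → asym (rot h) (rot h) })

  ¬CCW⇒NonNeg : ¬ CCW u v w → NonNeg (det (point v) (point u) (point w))
  ¬CCW⇒NonNeg {u} {v} {w} ¬h = det-flip (point v) (point u) (point w) (λ p → ¬h (ccw p))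

  CCW⇒NonNeg : CCW u v w → NonNeg (det (point u) (point v) (point w))
  CCW⇒NonNeg {u} {v} {w} (ccw p) = Pos⇒NonNeg {det (point u) (point v) (point w)} p

  record Inside (x u v w : Vertex) : Set where
    constructor inside
    field
      uvx : CCW u v x
      vwx : CCW v w x
      wux : CCW w u x

  open Inside

  Inside-rot : Inside x u v w → Inside x v w u
  Inside-rot (inside h₁ h₂ h₃) = inside h₂ h₃ h₁

  Inside⇒CCW : Inside x u v w → CCW u v w
  Inside⇒CCW {x} {u} {v} {w} (inside (ccw h₁) (ccw h₂) (ccw h₃)) =
    ccw (det-sum (point u) (point v) (point w) (point x) h₁ h₂ h₃)

  Inside-antisym : Inside x u v w → ¬ Inside w u v x
  Inside-antisym i j = asym′ (vwx i) (vwx j)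

  In : Vertex → Vertex → Vertex → Vertex → Set
  In x u v w = Inside x u v w ⊎ Inside x v u w

  -- As x and y lie in the triangle zuv, so does the triangle zxy, and u is not interior to it.
  In-antisym : In x z u v → In y z u v → ¬ In u z x y
  In-antisym (inj₁ i) (inj₁ j) (inj₁ k) = asym′ (uvx i) (uvx k)
  In-antisym (inj₁ i) (inj₁ j) (inj₂ k) = asym′ (uvx j) (vwx k)
  In-antisym (inj₁ i) (inj₂ j) _        = asym (Inside⇒CCW i) (Inside⇒CCW j)
  In-antisym (inj₂ i) (inj₁ j) _        = asym (Inside⇒CCW j) (Inside⇒CCW i)
  In-antisym (inj₂ i) (inj₂ j) (inj₁ k) = asym″ (uvx j) (wux k)
  In-antisym (inj₂ i) (inj₂ j) (inj₂ k) = asym″ (uvx i) (uvx k)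

  In-antisym′ : In x u v w → ¬ In w u v x
  In-antisym′ (inj₁ i) (inj₁ j) = Inside-antisym i j
  In-antisym′ (inj₁ i) (inj₂ j) = asym (uvx i) (Inside⇒CCW j)
  In-antisym′ (inj₂ i) (inj₁ j) = asym (Inside⇒CCW j) (uvx i)
  In-antisym′ (inj₂ i) (inj₂ j) = Inside-antisym i j

  In-flip : In x u v w → In x v u w
  In-flip (inj₁ i) = inj₂ i
  In-flip (inj₂ i) = inj₁ i

  In-rot : In x u v w → In x v w u
  In-rot (inj₁ i) = inj₁ (Inside-rot i)
  In-rot (inj₂ i) = inj₂ (Inside-rot (Inside-rot i))

  ~⇒≢′ : u ~ v → v ≢ u
  ~⇒≢′ e = ≢-sym (~-irr e)

  record Rim (p₁ p₂ p₃ p₄ : Vertex) : Set where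
    constructor rim
    field
      12~ : p₁ ~ p₂
      23~ : p₂ ~ p₃
      34~ : p₃ ~ p₄
      41~ : p₄ ~ p₁
      1≢3 : p₁ ≢ p₃
      2≢4 : p₂ ≢ p₄

  record Hub (z p₁ p₂ p₃ p₄ : Vertex) : Set where
    constructor hub
    field
      z1 : z ~ p₁
      z2 : z ~ p₂
      z3 : z ~ p₃
      z4 : z ~ p₄

  -- This reflection keeps side 12 in front, so the clockwise case of an ear over it reduces to the
  -- counterclockwise one.
  Rim-reverse : Rim u v w x → Rim v u x w
  Rim-reverse (rim e₁ e₂ e₃ e₄ n₁ n₂) = rim (~-sym e₁) (~-sym e₄) (~-sym e₃) (~-sym e₂) n₂ n₁

  Hub-reverse : Hub z u v w x → Hub z v u x w
  Hub-reverse (hub e₁ e₂ e₃ e₄) = hub e₂ e₁ e₄ e₃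

  segment⊆image : (e : u ~ v) → ∀ p → p ∈ segment (point u) (point v) → p ∈ image (curve e)
  segment⊆image e p = proj₂ (straight e) {p}

  -- The signs make the two segments meet, whereas planarity allows this only at a common end. The
  -- negated orientations include the degenerate contacts.
  no-crossing : x ~ y → u ~ v → x ≢ u → x ≢ v → y ≢ u → y ≢ v →
    CCW u v x → ¬ CCW u v y → ¬ CCW y x v → ¬ CCW x y u → ⊥
  no-crossing {x} {y} {u} {v} e f x≢u x≢v y≢u y≢v (ccw h) ¬uvy ¬yxv ¬xyu =
    let p , p∈e , p∈f = segments-meet (point x) (point y) (point u) (point v) h
          (¬CCW⇒NonNeg ¬uvy) (¬CCW⇒NonNeg ¬yxv) (¬CCW⇒NonNeg ¬xyu)
        _ , ∈e , ∈f , _ = curves-cross e f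
          (λ { (inj₁ (x≡u , _)) → x≢u x≡u ; (inj₂ (x≡v , _)) → x≢v x≡v })
          {p} (segment⊆image e p p∈e) (segment⊆image f p p∈f)
    in disjoint ∈e ∈f
    where
    disjoint : ∀ {s} → s ≡ x ⊎ s ≡ y → ¬ (s ≡ u ⊎ s ≡ v)
    disjoint (inj₁ refl) (inj₁ x≡u) = x≢u x≡u
    disjoint (inj₁ refl) (inj₂ x≡v) = x≢v x≡v
    disjoint (inj₂ refl) (inj₁ y≡u) = y≢u y≡u
    disjoint (inj₂ refl) (inj₂ y≡v) = y≢v y≡v

  -- Signs of reals are undecidable in general; deciding them for the vertices is an assumption that
  -- `theorem2` discharges under a double negation.
  module _ (pos? : ∀ u v w → Dec (Pos (det (point u) (point v) (point w)))) where

    ccw? : ∀ u v w → Dec (CCW u v w)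
    ccw? u v w = map′ ccw area (pos? u v w)

    inside? : ∀ x u v w → Dec (Inside x u v w)
    inside? x u v w = map′ (λ (h₁ , h₂ , h₃) → inside h₁ h₂ h₃)
      (λ (inside h₁ h₂ h₃) → h₁ , h₂ , h₃) (ccw? u v x ×-dec ccw? v w x ×-dec ccw? w u x)

    in? : ∀ x u v w → Dec (In x u v w)
    in? x u v w = inside? x u v w ⊎-dec inside? x v u w

    -- If the three points were collinear, one would lie on the edge between the other two, against
    -- `curves-avoid`.
    triangle-oriented : u ~ v → u ~ w → v ~ w → ¬ CCW u v w → CCW v u w
    triangle-oriented {u} {v} {w} e f g ¬uvw with ccw? v u w
    ... | yes vuw = vuw
    ... | no ¬vuw = ⊥-elim (collinear⇒between (point u) (point v) (point w)
      (points-distinct (~-irr e)) (points-distinct (~-irr f)) (points-distinct (~-irr g))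
      (λ p → ¬uvw (ccw p)) (λ p → ¬vuw (ccw p)) λ where
        (inj₁ w∈) → curves-avoid e (≢-sym (~-irr f)) (≢-sym (~-irr g)) (segment⊆image e (point w) w∈)
        (inj₂ (inj₁ v∈)) → curves-avoid f (≢-sym (~-irr e)) (~-irr g) (segment⊆image f (point v) v∈)
        (inj₂ (inj₂ u∈)) → curves-avoid g (~-irr e) (~-irr f) (segment⊆image g (point u) u∈))

    -- Otherwise one of the edges ux, vx crosses one of vw, uw.
    nested : u ~ v → u ~ w → v ~ w → u ~ x → v ~ x → w ≢ x →
      CCW u v w → CCW u v x → Inside x u v w ⊎ Inside w u v x
    nested {u} {v} {w} {x} uv uw vw ux vx w≢x h k = decide (ccw? v w x) (ccw? w u x) (ccw? v x w) (ccw? x u w)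
      where
      vx∦uw : ¬ CCW w u x → ¬ CCW v x w → ⊥
      vx∦uw ¬wux ¬vxw = no-crossing vx (~-sym uw) (~-irr vw) (≢-sym (~-irr uv))
        (≢-sym w≢x) (≢-sym (~-irr ux)) (rot (rot h)) ¬wux (λ p → asym k (rot p)) ¬vxw
      ux∦vw : ¬ CCW v w x → ¬ CCW x u w → ⊥
      ux∦vw ¬vwx ¬xuw = no-crossing ux vw (~-irr uv) (~-irr uw)
        (≢-sym (~-irr vx)) (≢-sym w≢x) (rot h) ¬vwx ¬xuw (λ p → asym′ k p)
      decide : Dec (CCW v w x) → Dec (CCW w u x) → Dec (CCW v x w) → Dec (CCW x u w) →
               Inside x u v w ⊎ Inside w u v x
      decide (yes vwx) (yes wux) _ _ = inj₁ (inside k vwx wux)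
      decide (yes vwx) (no ¬wux) _ _ = ⊥-elim (vx∦uw ¬wux (asym′ vwx))
      decide (no ¬vwx) _ _ (no ¬xuw) = ⊥-elim (ux∦vw ¬vwx ¬xuw)
      decide (no _) _ (yes vxw) (yes xuw) = inj₂ (inside h vxw xuw)
      decide (no _) _ (no ¬vxw) (yes xuw) = ⊥-elim (vx∦uw (λ wux → asym″ wux xuw) ¬vxw)

    -- The edge to a `y` beyond side `u v` has to leave the triangle, and all sides are edges. Which
    -- side it would cross depends on how the line `x y` passes the corners.
    no-escape : u ~ v → v ~ w → w ~ u → x ~ y → y ≢ u → y ≢ v → y ≢ w →
      Inside x u v w → ¬ ¬ CCW u v y
    no-escape {u} {v} {w} {x} {y} uv vw wu xy y≢u y≢v y≢w i@(inside h₁ h₂ h₃) ¬uvy =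
      around (ccw? y x v) (ccw? x y u)
      where
      pu = point u
      pv = point v
      pw = point w
      px = point x
      py = point y
      uvw = Inside⇒CCW i
      x≢u = proj₁ (CCW⇒≢ h₁)
      x≢v = proj₂ (CCW⇒≢ h₁)
      x≢w = proj₂ (CCW⇒≢ h₂)
      everywhere-outside : ¬ CCW v w y → ¬ CCW w u y → ⊥
      everywhere-outside ¬vwy ¬wuy = outside-all pu pv pw py (area uvw)
        (¬CCW⇒NonNeg ¬uvy) (¬CCW⇒NonNeg ¬vwy) (¬CCW⇒NonNeg ¬wuy)
      -- Having passed `v` on the wrong side, the line leaves through `v w`, unless it passes `w`
      -- wrongly too; then `y` would be outside all three sides.
      leftwards : CCW y x v → ¬ CCW v w y → ⊥
      leftwards yxv ¬vwy with ccw? y x w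
      ... | no ¬yxw = no-crossing xy vw x≢v x≢w y≢v y≢w h₂ ¬vwy ¬yxw (asym yxv)
      ... | yes yxw = everywhere-outside ¬vwy λ wuy → exit-left pv pw pu px py
        (area (rot uvw)) (area h₂) (area h₃) (¬CCW⇒NonNeg ¬vwy) (area yxw) (CCW⇒NonNeg wuy)
      rightwards : CCW x y u → ¬ CCW w u y → ⊥
      rightwards xyu ¬wuy with ccw? x y w
      ... | no ¬xyw = no-crossing xy wu x≢w x≢u y≢w y≢u h₃ ¬wuy (asym xyu) ¬xyw
      ... | yes xyw = everywhere-outside (λ vwy → exit-right pw pu pv px py
        (area (rot (rot uvw))) (area h₃) (area h₂) (¬CCW⇒NonNeg ¬wuy) (area xyw) (CCW⇒NonNeg vwy)) ¬wuy
      around : Dec (CCW y x v) → Dec (CCW x y u) → ⊥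
      around (yes yxv) _ = leftwards yxv λ vwy → exit-left pu pv pw px py
        (area uvw) (area h₁) (area h₂) (¬CCW⇒NonNeg ¬uvy) (area yxv) (CCW⇒NonNeg vwy)
      around (no _) (yes xyu) = rightwards xyu λ wuy → exit-right pu pv pw px py
        (area uvw) (area h₁) (area h₃) (¬CCW⇒NonNeg ¬uvy) (area xyu) (CCW⇒NonNeg wuy)
      around (no ¬yxv) (no ¬xyu) = no-crossing xy uv x≢u x≢v y≢u y≢v h₁ ¬uvy ¬yxv ¬xyu

    -- `no-escape` for each side in turn. Containment thus travels along paths that avoid the
    -- corners.
    transfer : u ~ v → v ~ w → w ~ u → x ~ y → y ≢ u → y ≢ v → y ≢ w →
      Inside x u v w → Inside y u v w
    transfer {u} {v} {w} {x} {y} uv vw wu xy y≢u y≢v y≢w i = inside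
      (stable u v (no-escape uv vw wu xy y≢u y≢v y≢w i))
      (stable v w (no-escape vw wu uv xy y≢v y≢w y≢u (Inside-rot i)))
      (stable w u (no-escape wu uv vw xy y≢w y≢u y≢v (Inside-rot (Inside-rot i))))
      where
      stable : ∀ s t → ¬ ¬ CCW s t y → CCW s t y
      stable s t = decidable-stable (ccw? s t y)

    transfer-In : u ~ v → v ~ w → w ~ u → x ~ y → y ≢ u → y ≢ v → y ≢ w → In x u v w → In y u v w
    transfer-In uv vw wu xy y≢u y≢v y≢w (inj₁ i) = inj₁ (transfer uv vw wu xy y≢u y≢v y≢w i)
    transfer-In uv vw wu xy y≢u y≢v y≢w (inj₂ i) =
      inj₂ (transfer (~-sym uv) (~-sym wu) (~-sym vw) xy y≢v y≢u y≢w i)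

    -- Some side of the triangle has `x` on its inner side, and `nested` applies to the two
    -- triangles over that side.
    K₄-nested : u ~ v → v ~ w → w ~ u → x ~ u → x ~ v → x ~ w → CCW u v w → ¬ Inside x u v w →
      Inside w u v x ⊎ Inside u v w x ⊎ Inside v w u x
    K₄-nested {u} {v} {w} {x} uv vw wu xu xv xw uvw ¬in with ccw? u v x | ccw? v w x | ccw? w u x
    ... | yes uvx | _ | _ = [ (λ i → ⊥-elim (¬in i)) , inj₁ ]′
      (nested uv (~-sym wu) vw (~-sym xu) (~-sym xv) (~⇒≢′ xw) uvw uvx)
    ... | no _ | yes vwx | _ = [ (λ i → ⊥-elim (¬in (Inside-rot (Inside-rot i)))) , (λ i → inj₂ (inj₁ i)) ]′
      (nested vw (~-sym uv) wu (~-sym xv) (~-sym xw) (~⇒≢′ xu) (rot uvw) vwx)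
    ... | no _ | no _ | yes wux = [ (λ i → ⊥-elim (¬in (Inside-rot i))) , (λ i → inj₂ (inj₂ i)) ]′
      (nested wu (~-sym vw) uv (~-sym xw) (~-sym xu) (~⇒≢′ xv) (rot (rot uvw)) wux)
    ... | no ¬uvx | no ¬vwx | no ¬wux = ⊥-elim (outside-all (point u) (point v) (point w) (point x)
      (area uvw) (¬CCW⇒NonNeg ¬uvx) (¬CCW⇒NonNeg ¬vwx) (¬CCW⇒NonNeg ¬wux))

    module _ {z m x y} (zm : z ~ m) (zx : z ~ x) (zy : z ~ y) (mx : m ~ x) (my : m ~ y)
             (x≢y : x ≢ y) (y∉ : ¬ In y z m x) (x∉ : ¬ In x z m y) where

      -- Triangles over `z m` on the same side would be nested, so `x` and `y` lie on opposite sides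
      -- and the path `x m y` keeps turning the same way around `z`.
      turn-left : CCW z x m → CCW z m y
      turn-left zxm with ccw? z m y
      ... | yes zmy = zmy
      ... | no ¬zmy = ⊥-elim ([ (λ i → y∉ (inj₂ i)) , (λ i → x∉ (inj₂ i)) ]′
        (nested (~-sym zm) mx zx my zy x≢y (rot (rot zxm)) (triangle-oriented zm zy my ¬zmy)))

      turn-right : CCW z m x → CCW z y m
      turn-right zmx with ccw? z m y
      ... | yes zmy = ⊥-elim ([ (λ i → y∉ (inj₁ i)) , (λ i → x∉ (inj₁ i)) ]′
        (nested zm zx mx zy my x≢y zmx zmy))
      ... | no ¬zmy = rot (triangle-oriented zm zy my ¬zmy)

    -- Far sides of a four-cycle seen from a common neighbour

    module _ {z p₁ p₂ p₃ p₄} (R : Rim p₁ p₂ p₃ p₄) (H : Hub z p₁ p₂ p₃ p₄) where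
      open Rim R
      open Hub H

      -- All signs but that of 43z are among those of the two containments. It comes from turning at
      -- `p₃`: if `p₄` were in `z p₃ p₂`, so would be its neighbour `p₁`.
      Inside⇒Far : Inside p₃ z p₁ p₂ → Inside p₄ z p₁ p₂ →
        Far (point z) (point p₁) (point p₂) (point p₃) (point p₄)
      Inside⇒Far i₃ i₄ = far (area (vwx i₄)) (area (vwx i₃)) (area (rot (rot (wux i₃))))
        (area (rot (uvx i₄))) (area (rot z43))
        where
        1∉ : ¬ In p₁ z p₃ p₂
        1∉ (inj₁ i) = asym′ (uvx i₃) (uvx i)
        1∉ (inj₂ i) = asym′ (Inside⇒CCW i₃) (vwx i)
        4∉ : ¬ In p₄ z p₃ p₂
        4∉ i = 1∉ (transfer-In z3 (~-sym 23~) (~-sym z2) 41~ (~⇒≢′ z1) 1≢3 (~-irr 12~) i)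
        2∉ : ¬ In p₂ z p₃ p₄
        2∉ (inj₁ i) = asym″ (wux i₄) (wux i)
        2∉ (inj₂ i) = asym″ (wux i₃) (uvx i)
        z43 : CCW z p₄ p₃
        z43 = turn-right z3 z2 z4 (~-sym 23~) 34~ 2≢4 4∉ 2∉ (rot (wux i₃))

      module _ {x} (xz : x ~ z) (x1 : x ~ p₁) (x2 : x ~ p₂) (x≢3 : x ≢ p₃) (x≢4 : x ≢ p₄) where

        -- In each of the three cases of K₄-nested, p₃ and p₄ are trapped in a
        -- triangle with corner x.
        ear-covers-rim : CCW z p₁ p₂ → ¬ Inside x z p₁ p₂ → ¬ ¬ Inside p₃ z p₁ p₂
        ear-covers-rim z12 x∉ 3∉ = [ trapped₁ , [ trapped₂ , trapped₃ ]′ ]′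
          (K₄-nested z1 12~ (~-sym z2) xz x1 x2 z12 x∉)
          where
          4∉ : ¬ Inside p₄ z p₁ p₂
          4∉ i = 3∉ (transfer z1 12~ (~-sym z2) (~-sym 34~) (~⇒≢′ z3) (≢-sym 1≢3) (~⇒≢′ 23~) i)

          trapped₁ : ¬ Inside p₂ z p₁ x
          -- If `p₂` were in `z p₁ p₄`, so would be its neighbour `x`, although `p₄` is in `z p₁ x`.
          trapped₁ i₂ = [ 4∉ , (λ i → Inside-antisym
              (transfer z1 (~-sym 41~) (~-sym z4) (~-sym x2) (~-irr xz) (~-irr x1) x≢4 i) i₄) ]′
            (nested z1 z2 12~ z4 (~-sym 41~) 2≢4 z12 (uvx i₄))
            where
            i₃ : Inside p₃ z p₁ x
            i₃ = transfer z1 (~-sym x1) xz 23~ (~⇒≢′ z3) (≢-sym 1≢3) (≢-sym x≢3) i₂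
            i₄ : Inside p₄ z p₁ x
            i₄ = transfer z1 (~-sym x1) xz 34~ (~⇒≢′ z4) (~-irr 41~) (≢-sym x≢4) i₃

          trapped₃ : ¬ Inside p₁ p₂ z x
          trapped₃ i₁ = [ (λ i → 3∉ (Inside-rot i)) , (λ i → Inside-antisym
              (transfer (~-sym z2) z3 (~-sym 23~) (~-sym x1) (~-irr x2) (~-irr xz) x≢3 i) i₃) ]′
            (nested (~-sym z2) (~-sym 12~) z1 23~ z3 1≢3 (rot (rot z12)) (uvx i₃))
            where
            i₄ : Inside p₄ p₂ z x
            i₄ = transfer (~-sym z2) (~-sym xz) x2 (~-sym 41~) (≢-sym 2≢4) (~⇒≢′ z4) (≢-sym x≢4) i₁
            i₃ : Inside p₃ p₂ z x
            i₃ = transfer (~-sym z2) (~-sym xz) x2 (~-sym 34~) (~⇒≢′ 23~) (~⇒≢′ z3) (≢-sym x≢3) i₄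

          trapped₂ : ¬ Inside z p₁ p₂ x
          -- Here `p₄` is confined to the part `z x p₁` of the triangle around `z`, and `p₃` and
          -- `p₂` follow along the rim; but `p₂` is on the other side of `z p₁`.
          trapped₂ i = asym (wux i₂) z12
            where
            i₄ : Inside p₄ p₁ p₂ x
            i₄ = transfer 12~ (~-sym x2) x1 z4 (~-irr 41~) (≢-sym 2≢4) (≢-sym x≢4) i
            ¬z14 : ¬ CCW z p₁ p₄
            ¬z14 z14 = [ 4∉ , (λ j → asym′ (uvx i₄) (vwx j)) ]′
              (nested z1 z2 12~ z4 (~-sym 41~) 2≢4 z12 z14)
            zx1 : CCW z x p₁
            zx1 = rot (rot (wux i))
            zx4 : ¬ ¬ CCW z x p₄
            zx4 ¬zx4 = no-crossing (~-sym 41~) (~-sym xz) (~⇒≢′ z1) (~⇒≢′ x1) (~⇒≢′ z4) (≢-sym x≢4)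
              zx1 ¬zx4 (λ h → asym (wux i₄) (rot h)) (λ h → ¬z14 (rot (rot h)))
            j₄ : Inside p₄ z x p₁
            j₄ = inside (decidable-stable (ccw? z x p₄) zx4) (wux i₄)
              (triangle-oriented z1 z4 (~-sym 41~) ¬z14)
            j₃ : Inside p₃ z x p₁
            j₃ = transfer (~-sym xz) x1 (~-sym z1) (~-sym 34~) (~⇒≢′ z3) (≢-sym x≢3) (≢-sym 1≢3) j₄
            i₂ : Inside p₂ z x p₁
            i₂ = transfer (~-sym xz) x1 (~-sym z1) (~-sym 23~) (~⇒≢′ z2) (~⇒≢′ x2) (~⇒≢′ 12~) j₃

        ear⁺ : CCW z p₁ p₂ → ¬ Inside x z p₁ p₂ →
          Far (point z) (point p₁) (point p₂) (point p₃) (point p₄)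
        ear⁺ z12 x∉ = Inside⇒Far i₃
          (transfer z1 12~ (~-sym z2) 34~ (~⇒≢′ z4) (~-irr 41~) (≢-sym 2≢4) i₃)
          where
          i₃ = decidable-stable (inside? p₃ z p₁ p₂) (ear-covers-rim z12 x∉)

    -- Used with some q as `z` and its r as `x`: an r outside the sector of its side makes this side
    -- far. The clockwise case is the mirror image.
    ear : ∀ {z x p₁ p₂ p₃ p₄} → Rim p₁ p₂ p₃ p₄ → Hub z p₁ p₂ p₃ p₄ →
      x ~ z → x ~ p₁ → x ~ p₂ → x ≢ p₃ → x ≢ p₄ → ¬ In x z p₁ p₂ →
      Far (point z) (point p₁) (point p₂) (point p₃) (point p₄) ⊎
      Far (point z) (point p₂) (point p₁) (point p₄) (point p₃)
    ear {z} {x} {p₁} {p₂} R H xz x1 x2 x≢3 x≢4 x∉ with ccw? z p₁ p₂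
    ... | yes z12 = inj₁ (ear⁺ R H xz x1 x2 x≢3 x≢4 z12 (λ i → x∉ (inj₁ i)))
    ... | no ¬z12 = inj₂ (ear⁺ (Rim-reverse R) (Hub-reverse H) xz x2 x1 x≢4 x≢3
      (rot (triangle-oriented z1 z2 12~ ¬z12)) (λ i → x∉ (inj₂ (Inside-rot (Inside-rot i)))))
      where
      open Rim R
      open Hub H

    -- The rim signs of the two configurations would make the sides 23 and 41 cross.
    no-reversed-far : ∀ {x y p₁ p₂ p₃ p₄} → Rim p₁ p₂ p₃ p₄ →
      Far x (point p₁) (point p₂) (point p₃) (point p₄) →
      ¬ Far y (point p₄) (point p₃) (point p₂) (point p₁)
    no-reversed-far R F G = no-crossing (~-sym 41~) 23~ (~-irr 12~) 1≢3 (≢-sym 2≢4) (~⇒≢′ 34~)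
      (rot (ccw F.123>0)) (asym″ (ccw G.123>0)) (asym′ (ccw G.124>0)) (asym′ (ccw F.124>0))
      where
      open Rim R
      module F = Far F
      module G = Far G

    opposite-ears : ∀ {x y p₁ p₂ p₃ p₄} → Rim p₁ p₂ p₃ p₄ →
      Far x (point p₁) (point p₂) (point p₃) (point p₄) ⊎
      Far x (point p₂) (point p₁) (point p₄) (point p₃) →
      Far y (point p₃) (point p₄) (point p₁) (point p₂) ⊎
      Far y (point p₄) (point p₃) (point p₂) (point p₁) → ⊥
    opposite-ears R (inj₁ F) (inj₁ G) = no-opposite-far F G
    opposite-ears R (inj₁ F) (inj₂ G) = no-reversed-far R F G
    opposite-ears R (inj₂ F) (inj₁ G) = no-reversed-far (Rim-reverse R) F G
    opposite-ears R (inj₂ F) (inj₂ G) = no-opposite-far F G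

    -- Two vertices adjacent to a whole ring

    module _ {p : Fin 4 → Vertex} (side : ∀ i → p i ~ p (next i))
             (diagonal : ∀ i → p i ≢ p (next (next i))) where

      Encloses : Vertex → Vertex → Set
      Encloses z x = ∃[ i ] In x z (p i) (p (next i))

      encloses? : ∀ z x → Dec (Encloses z x)
      encloses? z x = Fin.any? (λ i → in? x z (p i) (p (next i)))

      module _ {z y} (z~ : ∀ i → z ~ p i) (y~ : ∀ i → y ~ p i) (z≢y : z ≢ y)
               (y∉ : ¬ Encloses z y) where

        private
          -- A ring vertex in this triangle would bring its neighbour `y` along, against `y∉`.
          ahead∉ : ∀ i → ¬ In (p (next (next i))) z (p (next i)) (p i)
          ahead∉ i h = y∉ (i , transfer-In (z~ i) (side i) (~-sym (z~ (next i)))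
            (~-sym (y~ (next (next i)))) (≢-sym z≢y) (~-irr (y~ i)) (~-irr (y~ (next i)))
            (In-rot (In-flip h)))

          behind∉ : ∀ i → ¬ In (p i) z (p (next i)) (p (next (next i)))
          behind∉ i h = y∉ (next i , transfer-In (z~ (next i)) (side (next i))
            (~-sym (z~ (next (next i)))) (~-sym (y~ i)) (≢-sym z≢y)
            (~-irr (y~ (next i))) (~-irr (y~ (next (next i)))) h)

        turn : ∀ i → CCW z (p i) (p (next i)) → CCW z (p (next i)) (p (next (next i)))
        turn i = turn-left (z~ (next i)) (z~ i) (z~ (next (next i)))
          (~-sym (side i)) (side (next i)) (diagonal i) (ahead∉ i) (behind∉ i)

        -- If both hubs saw side `i` in the same direction, their triangles over it would be nested
        -- and one hub would enclose the other.
        opposite : ¬ Encloses y z → ∀ i → CCW z (p i) (p (next i)) → CCW y (p (next i)) (p i)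
        opposite z∉ i h with ccw? y (p (next i)) (p i)
        ... | yes k = k
        ... | no ¬k = ⊥-elim ([ (λ j → y∉ (i , inj₁ (Inside-rot (Inside-rot j))))
                              , (λ j → z∉ (i , inj₁ (Inside-rot (Inside-rot j)))) ]′
          (nested (side i) (~-sym (z~ i)) (~-sym (z~ (next i))) (~-sym (y~ i)) (~-sym (y~ (next i)))
            z≢y (rot h) (rot (rot (triangle-oriented (y~ (next i)) (y~ i) (~-sym (side i)) ¬k)))))

        -- Otherwise `z` sees all four sides counterclockwise and `y` all four clockwise, giving the
        -- quadrilateral two signed areas.
        not-around : ¬ Encloses y z → ¬ CCW z (p 0F) (p 1F)
        not-around z∉ h₀ = no-opposite-areas (point z) (point y)
            (point (p 0F)) (point (p 1F)) (point (p 2F)) (point (p 3F))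
            (area h₀) (area h₁) (area h₂) (area h₃)
            (area (opposite z∉ 0F h₀)) (area (opposite z∉ 1F h₁))
            (area (opposite z∉ 2F h₂)) (area (opposite z∉ 3F h₃))
          where
          h₁ = turn 0F h₀
          h₂ = turn 1F h₁
          h₃ = turn 2F h₂

      -- One of the hubs sees the first side counterclockwise, since two clockwise triangles over it
      -- would be nested; then `not-around` applies.
      hubs-enclose : ∀ {z y} → (∀ i → z ~ p i) → (∀ i → y ~ p i) → z ≢ y →
        ¬ Encloses z y → ¬ ¬ Encloses y z
      hubs-enclose {z} {y} z~ y~ z≢y y∉ z∉ with ccw? z (p 0F) (p 1F)
      ... | yes h = not-around z~ y~ z≢y y∉ z∉ h
      ... | no ¬h = not-around y~ z~ (≢-sym z≢y) z∉ y∉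
        (decidable-stable (ccw? y (p 0F) (p 1F)) λ ¬k →
          [ (λ i → y∉ (0F , inj₂ (Inside-rot i))) , (λ i → z∉ (0F , inj₂ (Inside-rot i))) ]′
            (nested (~-sym (side 0F)) (~-sym (z~ 1F)) (~-sym (z~ 0F)) (~-sym (y~ 1F)) (~-sym (y~ 0F))
              z≢y (rot (rot (triangle-oriented (z~ 0F) (z~ 1F) (side 0F) ¬h)))
              (rot (rot (triangle-oriented (y~ 0F) (y~ 1F) (side 0F) ¬k)))))

    -- Three disjoint rings with common neighbours

    module _ {p : Fin 3 → Fin 4 → Vertex} (side : ∀ κ i → p κ i ~ p κ (next i))
             (diagonal : ∀ κ i → p κ i ≢ p κ (next (next i)))
             (apart : ∀ {κ κ′} → κ ≢ κ′ → ∀ i j → p κ i ≢ p κ′ j) where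

      -- For distinct rings, each triangle would by adjacency to `x` catch ends of the other ring's
      -- side, against `In-antisym`.
      In-one-sector : ∀ {z x κ κ′} i j → (∀ κ i → z ~ p κ i) →
        x ~ p κ i → x ~ p κ′ j → x ~ p κ′ (next j) →
        In x z (p κ i) (p κ (next i)) → In x z (p κ′ j) (p κ′ (next j)) → κ ≡ κ′
      In-one-sector {z} {x} {κ} {κ′} i j z~ xi xj xj⁺ h k = decidable-stable (κ Fin.≟ κ′) λ κ≢κ′ →
        In-antisym (into i j κ≢κ′ xj h) (into i (next j) κ≢κ′ xj⁺ h) (into j i (≢-sym κ≢κ′) xi k)
        where
        into : ∀ {κ κ′} i j → κ ≢ κ′ → x ~ p κ′ j →
          In x z (p κ i) (p κ (next i)) → In (p κ′ j) z (p κ i) (p κ (next i))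
        into {κ} {κ′} i j κ≢κ′ xj = transfer-In (z~ κ i) (side κ i) (~-sym (z~ κ (next i))) xj
          (~⇒≢′ (z~ κ′ j)) (apart (≢-sym κ≢κ′) j i) (apart (≢-sym κ≢κ′) j (next i))

      -- On every ring one hub encloses the other, so on two of the three rings it is the same one;
      -- but a hub can enclose the other on one ring only.
      unique-hub : ∀ {z y} → (∀ κ i → z ~ p κ i) → (∀ κ i → y ~ p κ i) → z ≢ y → ⊥
      unique-hub {z} {y} z~ y~ z≢y = clash (Fin.pigeonhole (ℕ.n<1+n 2) (λ κ → bit (z⊃y? κ)))
        where
        z⊃y? : ∀ κ → Dec (Encloses (side κ) (diagonal κ) z y)
        z⊃y? κ = encloses? (side κ) (diagonal κ) z y
        unique : ∀ {z y κ κ′} → (∀ κ i → z ~ p κ i) → (∀ κ i → y ~ p κ i) →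
          Encloses (side κ) (diagonal κ) z y → Encloses (side κ′) (diagonal κ′) z y → κ ≡ κ′
        unique z~ y~ (i , h) (j , k) =
          In-one-sector i j z~ (y~ _ i) (y~ _ j) (y~ _ (next j)) h k
        clash : ∃[ κ ] ∃[ κ′ ] κ Fin.< κ′ × bit (z⊃y? κ) ≡ bit (z⊃y? κ′) → ⊥
        clash (κ , κ′ , κ<κ′ , eq) with bit-agree (z⊃y? κ) (z⊃y? κ′) eq
        ... | inj₁ (h , k) = Fin.<⇒≢ κ<κ′ (unique z~ y~ h k)
        ... | inj₂ (¬h , ¬k) =
          hubs-enclose (side κ) (diagonal κ) (z~ κ) (y~ κ) z≢y ¬h λ h →
          hubs-enclose (side κ′) (diagonal κ′) (z~ κ′) (y~ κ′) z≢y ¬k λ k →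
          Fin.<⇒≢ κ<κ′ (unique y~ z~ h k)

      rim-from : ∀ κ i → Rim (p κ i) (p κ (next i)) (p κ (next (next i))) (p κ (next (next (next i))))
      rim-from κ i = rim (side κ i) (side κ (next i)) (side κ (next (next i)))
        (subst (λ j → p κ (next (next (next i))) ~ p κ j) (next⁴ i) (side κ (next (next (next i)))))
        (diagonal κ i) (diagonal κ (next i))

    -- Many common neighbours of three vertices

    -- The class of a hub records its side of `u v` and whether its triangle over `u v` contains
    -- `w`. Two hubs on one side are nested, and `w`, adjacent to both, must be in the outer
    -- triangle but not in the inner one; so the four classes hold at most one hub each.
    crowded : ∀ {n u v w} (h : Fin n → Vertex) → 4 ℕ.< n → (∀ {i j} → i ≢ j → h i ≢ h j) →
      u ~ v → w ≢ u → w ≢ v → (∀ i → h i ~ u) → (∀ i → h i ~ v) → (∀ i → h i ~ w) → ⊥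
    crowded {n} {u} {v} {w} h 4<n distinct uv w≢u w≢v hu hv hw = clash (Fin.pigeonhole 4<n class)
      where
      side? : ∀ i → Dec (CCW u v (h i))
      side? i = ccw? u v (h i)
      covers? : ∀ i → Dec (In w u v (h i))
      covers? i = in? w u v (h i)
      class : Fin n → Fin 4
      class i = Fin.combine (bit (side? i)) (bit (covers? i))

      inner-excluded : ∀ {i j} → i ≢ j → In (h j) u v (h i) →
        In w u v (h i) × In w u v (h j) ⊎ ¬ In w u v (h i) × ¬ In w u v (h j) → ⊥
      inner-excluded {i} {j} i≢j h∈ (inj₁ (_ , w∈)) = In-antisym′ h∈
        (transfer-In uv (~-sym (hv j)) (hu j) (~-sym (hw i)) (~-irr (hu i)) (~-irr (hv i)) (distinct i≢j) w∈)
      inner-excluded {i} {j} i≢j h∈ (inj₂ (w∉ , _)) = w∉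
        (transfer-In uv (~-sym (hv i)) (hu i) (hw j) w≢u w≢v (~⇒≢′ (hw i)) h∈)

      same-side : ∀ {i j} → i ≢ j →
        CCW u v (h i) × CCW u v (h j) ⊎ ¬ CCW u v (h i) × ¬ CCW u v (h j) →
        In (h j) u v (h i) ⊎ In (h i) u v (h j)
      same-side {i} {j} i≢j (inj₁ (k , l)) = [ (λ m → inj₁ (inj₁ m)) , (λ m → inj₂ (inj₁ m)) ]′
        (nested uv (~-sym (hu i)) (~-sym (hv i)) (~-sym (hu j)) (~-sym (hv j)) (distinct i≢j) k l)
      same-side {i} {j} i≢j (inj₂ (¬k , ¬l)) = [ (λ m → inj₁ (inj₂ m)) , (λ m → inj₂ (inj₂ m)) ]′
        (nested (~-sym uv) (~-sym (hv i)) (~-sym (hu i)) (~-sym (hv j)) (~-sym (hu j)) (distinct i≢j)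
          (clockwise i ¬k) (clockwise j ¬l))
        where
        clockwise : ∀ i → ¬ CCW u v (h i) → CCW v u (h i)
        clockwise i = triangle-oriented uv (~-sym (hu i)) (~-sym (hv i))

      clash : ∃[ i ] ∃[ j ] i Fin.< j × class i ≡ class j → ⊥
      clash (i , j , i<j , eq) =
        let side-eq , covers-eq = Fin.combine-injective (bit (side? i)) (bit (covers? i))
                                    (bit (side? j)) (bit (covers? j)) eq
            covers = bit-agree (covers? i) (covers? j) covers-eq
        in [ (λ k → inner-excluded (Fin.<⇒≢ i<j) k covers)
           , (λ k → inner-excluded (≢-sym (Fin.<⇒≢ i<j)) k (Sum.map Product.swap Product.swap covers)) ]′
           (same-side (Fin.<⇒≢ i<j) (bit-agree (side? i) (side? j) side-eq))

-- Extremal members of finite families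

greatest : ∀ {A : Set} {_≲_ : A → A → Set} → (∀ x y → x ≲ y ⊎ y ≲ x) →
  (∀ {x y z} → x ≲ y → y ≲ z → x ≲ z) →
  ∀ {n} (f : Fin (ℕ.suc n) → A) → ∃[ i ] ∀ j → f j ≲ f i
greatest total transitive {ℕ.zero} f = 0F , λ { 0F → [ (λ x → x) , (λ x → x) ]′ (total (f 0F) (f 0F)) }
greatest {_≲_ = _≲_} total transitive {ℕ.suc n} f with greatest {_≲_ = _≲_} total transitive (λ i → f (suc i))
... | i , max with total (f 0F) (f (suc i))
... | inj₁ 0≲i = suc i , λ { 0F → 0≲i ; (suc j) → max j }
... | inj₂ i≲0 = 0F , λ { 0F → [ (λ x → x) , (λ x → x) ]′ (total (f 0F) (f 0F))
                        ; (suc j) → transitive (max j) i≲0 }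

greatest₂ : ∀ {A : Set} {_≲_ : A → A → Set} → (∀ x y → x ≲ y ⊎ y ≲ x) →
  (∀ {x y z} → x ≲ y → y ≲ z → x ≲ z) →
  ∀ {m n} (f : Fin (ℕ.suc m) → Fin (ℕ.suc n) → A) → ∃[ i ] ∃[ j ] ∀ k l → f k l ≲ f i j
greatest₂ {_≲_ = _≲_} total transitive f =
  let row     = λ i → greatest {_≲_ = _≲_} total transitive (f i)
      i , max = greatest {_≲_ = _≲_} total transitive (λ i → f i (proj₁ (row i)))
  in i , proj₁ (row i) , λ k l → transitive (proj₂ (row k) l) (max k)

-- Rings and adjacencies of the graph

ring : Fin 3 → Fin 4 → V
ring 0F = a
ring 1F = b
ring 2F = c

ring-side : ∀ κ i → ring κ i ⟶ ring κ (next i)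
ring-side 0F = aa
ring-side 1F = bb
ring-side 2F = cc

q⟶ring : ∀ i j κ k → q i j ⟶ ring κ k
q⟶ring i j 0F = qa i j
q⟶ring i j 1F = qb i j
q⟶ring i j 2F = qc i j

r⟶ring : ∀ i j κ → r i j ⟶ ring κ i
r⟶ring i j 0F = ra i j
r⟶ring i j 1F = rb i j
r⟶ring i j 2F = rc i j

r⟶ring-next : ∀ i j κ → r i j ⟶ ring κ (next i)
r⟶ring-next i j 0F = ra′ i j
r⟶ring-next i j 1F = rb′ i j
r⟶ring-next i j 2F = rc′ i j

i≢next² : ∀ i → i ≢ next (next i)
i≢next² 0F ()
i≢next² 1F ()
i≢next² 2F ()
i≢next² 3F ()

ring-injective : ∀ κ κ′ {i j} → ring κ i ≡ ring κ′ j → κ ≡ κ′ × i ≡ j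
ring-injective 0F 0F refl = refl , refl
ring-injective 1F 1F refl = refl , refl
ring-injective 2F 2F refl = refl , refl
ring-injective 0F 1F ()
ring-injective 0F 2F ()
ring-injective 1F 0F ()
ring-injective 1F 2F ()
ring-injective 2F 0F ()
ring-injective 2F 1F ()

r≢ring : ∀ {i j} κ k → r i j ≢ ring κ k
r≢ring 0F k ()
r≢ring 1F k ()
r≢ring 2F k ()

qs : Fin 8 → V
qs x = uncurry q (Fin.remQuot 2 x)

qs-injective : ∀ {x y} → qs x ≡ qs y → x ≡ y
qs-injective {x} {y} eq = trans (sym (Fin.combine-remQuot {4} 2 x))
  (trans (cong (uncurry Fin.combine) (q-injective eq)) (Fin.combine-remQuot {4} 2 y))
  where
  q-injective : ∀ {u v : Fin 4 × Fin 2} → uncurry q u ≡ uncurry q v → u ≡ v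
  q-injective refl = refl

-- Visible intervals

module _ {ℓ} (S : Storyplan 𝔾 ℓ) where
  open Graph 𝔾 using (_~_; ~-sym)
  open Storyplan S

  adjacent-overlap : ∀ {u v} → u ~ v → first u Fin.≤ last v
  adjacent-overlap e = let t , (fu≤t , _) , (_ , t≤lv) = meet e in ℕ.≤-trans fu≤t t≤lv

  latest : ∀ {m n} (f : Fin (ℕ.suc m) → Fin (ℕ.suc n) → Fin ℓ) →
           ∃[ i ] ∃[ j ] ∀ k l → f k l Fin.≤ f i j
  latest = greatest₂ Fin.≤-total ℕ.≤-trans

  earliest : ∀ {m n} (f : Fin (ℕ.suc m) → Fin (ℕ.suc n) → Fin ℓ) →
             ∃[ i ] ∃[ j ] ∀ k l → f i j Fin.≤ f k l
  earliest = greatest₂ {_≲_ = λ x y → y Fin.≤ x} (λ x y → Fin.≤-total y x) (λ h k → ℕ.≤-trans k h)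

  -- To meet its neighbour `w`, which starts only after `y`, `u` has to stay visible past `y`.
  visible-at-end : ∀ {u w} {y : Fin ℓ} → u ~ w → first u Fin.≤ y → y Fin.< first w → Visible y u
  visible-at-end e fu≤y y<fw = fu≤y , ℕ.≤-trans (ℕ.<⇒≤ y<fw) (adjacent-overlap (~-sym e))

  visible-at-start : ∀ {u w} {x : Fin ℓ} → u ~ w → x Fin.≤ last u → last w Fin.< x → Visible x u
  visible-at-start e x≤lu lw<x = ℕ.≤-trans (adjacent-overlap e) (ℕ.<⇒≤ lw<x) , x≤lu

  -- Helly's theorem for intervals, one of which is the window.
  common-time : ∀ {n} {x y : Fin ℓ} (v : Fin n → V) → x Fin.≤ y →
    (∀ i → first (v i) Fin.≤ y) → (∀ i → x Fin.≤ last (v i)) →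
    (∀ i j → first (v i) Fin.≤ last (v j)) →
    ∃[ t ] x Fin.≤ t × t Fin.≤ y × ∀ i → Visible t (v i)
  common-time {n} {x} {y} v x≤y f≤y x≤l f≤l with greatest {_≲_ = Fin._≤_} Fin.≤-total ℕ.≤-trans low
    where
    low : Fin (ℕ.suc n) → Fin ℓ
    low zero = x
    low (suc i) = first (v i)
  ... | zero  , max = x , max zero , x≤y , λ i → max (suc i) , x≤l i
  ... | suc k , max = first (v k) , max zero , f≤y k , λ i → max (suc i) , f≤l k i

  -- Frames of a planar geometric storyplan

  module _ (planar : PlanarGeometric S) where

    pt : V → Point
    pt = Drawing.point drawing

    module _ (pos? : ∀ u v w → Dec (Pos (det (pt u) (pt v) (pt w)))) where

      module AtTime (t : Fin ℓ) where
        open Frame (frame t) (proj₁ (planar t)) (λ {u} {v} → proj₂ (planar t) {u} {v}) public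
        orientation? : ∀ u v w → Dec (Pos (det (Drawing.point (frame t) u)
                         (Drawing.point (frame t) v) (Drawing.point (frame t) w)))
        orientation? u v w = pos? (value u) (value v) (value w)

      infix 5 _at_

      _at_ : ∀ {t} v → Visible t v → Refinement V (Visible t)
      v at h = v , [ h ]

      at-≢ : ∀ {t} {u v : Refinement V (Visible t)} → value u ≢ value v → u ≢ v
      at-≢ u≢v eq = u≢v (cong value eq)

      -- Intervals realise no chordless cycle, so some three consecutive members of
      -- the cycle a are seen together during the window, along with all of the q's.
      no-common-q-time : ∀ {x y : Fin ℓ} → x Fin.≤ y →
        (∀ i → first (qs i) Fin.≤ x) → (∀ i → y Fin.≤ last (qs i)) →
        (∀ i → first (a i) Fin.≤ y) → (∀ i → x Fin.≤ last (a i)) → ⊥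
      no-common-q-time {x} {y} x≤y qs≤x y≤qs f≤y x≤l =
        chord (first (a 0F) Fin.≤? last (a 2F)) (first (a 2F) Fin.≤? last (a 0F))
        where
        forward : ∀ i → first (a i) Fin.≤ last (a (next i))
        forward i = adjacent-overlap (inj₁ (aa i))
        backward : ∀ i → first (a (next i)) Fin.≤ last (a i)
        backward i = adjacent-overlap (inj₂ (aa i))

        three : ∀ i → first (a i) Fin.≤ last (a (next (next i))) →
                first (a (next (next i))) Fin.≤ last (a i) → ⊥
        three i fi≤ln fn≤li =
          let t , x≤t , t≤y , visible = common-time v x≤y
                (λ { 0F → f≤y i ; 1F → f≤y (next i) ; 2F → f≤y (next (next i)) })
                (λ { 0F → x≤l i ; 1F → x≤l (next i) ; 2F → x≤l (next (next i)) }) pairwise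
              open AtTime t
              visible-qs : ∀ k → Visible t (qs k)
              visible-qs k = ℕ.≤-trans (qs≤x k) x≤t , ℕ.≤-trans t≤y (y≤qs k)
          in crowded orientation? {u = a i at visible 0F} {v = a (next i) at visible 1F}
               {w = a (next (next i)) at visible 2F} (λ k → qs k at visible-qs k)
               (ℕ.s≤s (ℕ.s≤s (ℕ.s≤s (ℕ.s≤s (ℕ.s≤s ℕ.z≤n)))))
               (λ k≢l eq → k≢l (qs-injective (cong value eq)))
               (inj₁ (aa i)) (at-≢ (λ eq → i≢next² i (sym (a-injective eq))))
               (at-≢ (λ eq → ⟶-irr (aa (next i)) (sym eq)))
               (λ k → inj₁ (qa _ _ _)) (λ k → inj₁ (qa _ _ _)) (λ k → inj₁ (qa _ _ _))
          where
          a-injective : ∀ {i j} → a i ≡ a j → i ≡ j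
          a-injective refl = refl
          v : Fin 3 → V
          v 0F = a i
          v 1F = a (next i)
          v 2F = a (next (next i))
          pairwise : ∀ k l → first (v k) Fin.≤ last (v l)
          pairwise 0F 0F = nonempty (v 0F)
          pairwise 0F 1F = forward i
          pairwise 0F 2F = fi≤ln
          pairwise 1F 0F = backward i
          pairwise 1F 1F = nonempty (v 1F)
          pairwise 1F 2F = forward (next i)
          pairwise 2F 0F = fn≤li
          pairwise 2F 1F = backward (next i)
          pairwise 2F 2F = nonempty (v 2F)

        -- If u ends before w starts then both common neighbours of u and w fill the gap.
        gap : ∀ {u w s t : V} → last u Fin.< first w → first s Fin.≤ last u → first w Fin.≤ last t →
              first s Fin.≤ last t
        gap lu<fw fs≤lu fw≤lt = ℕ.≤-trans fs≤lu (ℕ.≤-trans (ℕ.<⇒≤ lu<fw) fw≤lt)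

        chord : Dec (first (a 0F) Fin.≤ last (a 2F)) → Dec (first (a 2F) Fin.≤ last (a 0F)) → ⊥
        chord (yes h) (yes k) = three 0F h k
        chord (no ¬h) _ = three 1F (gap {a 2F} {a 0F} {a 1F} {a 3F} (ℕ.≰⇒> ¬h) (forward 1F) (backward 3F))
                                   (gap {a 2F} {a 0F} {a 3F} {a 1F} (ℕ.≰⇒> ¬h) (backward 2F) (forward 0F))
        chord (yes _) (no ¬k) = three 1F (gap {a 0F} {a 2F} {a 1F} {a 3F} (ℕ.≰⇒> ¬k) (backward 0F) (forward 2F))
                                         (gap {a 0F} {a 2F} {a 3F} {a 1F} (ℕ.≰⇒> ¬k) (forward 3F) (backward 1F))

      -- The two alternatives are the two orientations of the ring. Points of the fixed drawing are
      -- used instead of frame vertices, so that facts from different times can be combined.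
      Chord : Point → Fin 3 → Fin 4 → Set
      Chord z κ i = Far z (p i) (p (next i)) (p (next (next i))) (p (next (next (next i)))) ⊎
                    Far z (p (next i)) (p i) (p (next (next (next i)))) (p (next (next i)))
        where
        p : Fin 4 → Point
        p k = pt (ring κ k)

      -- What the frame at a time when some q i j, r i j and all rings are visible tells:
      -- Split κ says that r i j lies in the triangle of q i j and side i of ring κ.
      record Eared (i : Fin 4) : Set₁ where
        field
          viewpoint : Point
          Split     : Fin 3 → Set
          split?    : ∀ κ → Dec (Split κ)
          unique    : ∀ {κ κ′} → Split κ → Split κ′ → κ ≡ κ′
          chord     : ∀ κ → ¬ Split κ → Chord viewpoint κ i

      -- A window of time in which all rings are visible

      module Window {x y : Fin ℓ} (x≤y : x Fin.≤ y)
             (rings : ∀ {t : Fin ℓ} → x Fin.≤ t → t Fin.≤ y → ∀ (κ : Fin 3) (i : Fin 4) → Visible t (ring κ i))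
             (q≤y : ∀ (i : Fin 4) (j : Fin 2) → first (q i j) Fin.≤ y)
             (x≤q : ∀ (i : Fin 4) (j : Fin 2) → x Fin.≤ last (q i j)) where

        module Within {t : Fin ℓ} (x≤t : x Fin.≤ t) (t≤y : t Fin.≤ y) where
          open AtTime t public

          p : Fin 3 → Fin 4 → Refinement V (Visible t)
          p κ i = ring κ i at rings x≤t t≤y κ i

          side : ∀ κ i → value (p κ i) ~ value (p κ (next i))
          side κ i = inj₁ (ring-side κ i)

          diagonal : ∀ κ i → p κ i ≢ p κ (next (next i))
          diagonal κ i = at-≢ λ eq → i≢next² i (proj₂ (ring-injective κ κ eq))

          apart : ∀ {κ κ′} → κ ≢ κ′ → ∀ i j → p κ i ≢ p κ′ j
          apart κ≢κ′ i j = at-≢ λ eq → κ≢κ′ (proj₁ (ring-injective _ _ eq))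

        one-q : ∀ {t} → x Fin.≤ t → t Fin.≤ y → ∀ {i j i′ j′} → Visible t (q i j) → Visible t (q i′ j′) →
                ¬ q i j ≢ q i′ j′
        one-q x≤t t≤y {i} {j} {i′} {j′} h k ≢q = unique-hub orientation? side diagonal apart
          {z = q i j at h} {y = q i′ j′ at k}
          (λ κ l → inj₁ (q⟶ring i j κ l)) (λ κ l → inj₁ (q⟶ring i′ j′ κ l)) (at-≢ ≢q)
          where open Within x≤t t≤y

        eared : ∀ {t} → x Fin.≤ t → t Fin.≤ y → ∀ i j → Visible t (q i j) → Visible t (r i j) → Eared i
        eared {t} x≤t t≤y i j hq hr = record
          { viewpoint = pt (q i j)
          ; Split     = λ κ → In ear-r hub-q (p κ i) (p κ (next i))
          ; split?    = λ κ → in? orientation? ear-r hub-q (p κ i) (p κ (next i))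
          ; unique    = λ {κ} {κ′} → In-one-sector orientation? side diagonal apart i i q~
                          (inj₁ (r⟶ring i j κ)) (inj₁ (r⟶ring i j κ′)) (inj₁ (r⟶ring-next i j κ′))
          ; chord     = λ κ ¬split → ear orientation? (rim-from orientation? side diagonal apart κ i)
                          (hub (q~ κ _) (q~ κ _) (q~ κ _) (q~ κ _))
                          (inj₁ (rq i j)) (inj₁ (r⟶ring i j κ)) (inj₁ (r⟶ring-next i j κ))
                          (at-≢ (r≢ring κ _)) (at-≢ (r≢ring κ _)) ¬split
          }
          where
          open Within x≤t t≤y
          hub-q ear-r : Refinement V (Visible t)
          hub-q = q i j at hq
          ear-r = r i j at hr
          q~ : ∀ κ k → value hub-q ~ value (p κ k)
          q~ κ k = inj₁ (q⟶ring i j κ k)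

        -- If `r i j` misses the window, `q i j` must wait for it at the corresponding end;
        -- otherwise the two share a time inside the window.
        locate : ∀ i j → Eared i ⊎ Visible y (q i j) ⊎ Visible x (q i j)
        locate i j with first (r i j) Fin.≤? y | x Fin.≤? last (r i j)
        ... | no r≰y | _ = inj₂ (inj₁ (visible-at-end (inj₂ (rq i j)) (q≤y i j) (ℕ.≰⇒> r≰y)))
        ... | yes _ | no x≰r = inj₂ (inj₂ (visible-at-start (inj₂ (rq i j)) (x≤q i j) (ℕ.≰⇒> x≰r)))
        ... | yes r≤y | yes x≤r =
          let t , x≤t , t≤y , visible = common-time v x≤y (λ { 0F → q≤y i j ; 1F → r≤y })
                (λ { 0F → x≤q i j ; 1F → x≤r }) pairwise
          in inj₁ (eared x≤t t≤y i j (visible 0F) (visible 1F))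
          where
          v : Fin 2 → V
          v 0F = q i j
          v 1F = r i j
          pairwise : ∀ k l → first (v k) Fin.≤ last (v l)
          pairwise 0F 0F = nonempty (q i j)
          pairwise 0F 1F = adjacent-overlap (inj₂ (rq i j))
          pairwise 1F 0F = adjacent-overlap (inj₁ (rq i j))
          pairwise 1F 1F = nonempty (r i j)

        -- As x sees at most one q, one of the two q's of a position without ears is seen at y.
        eared-or-end : ∀ i → Eared i ⊎ ∃[ j ] Visible y (q i j)
        eared-or-end i with locate i 0F | locate i 1F
        ... | inj₁ e | _ = inj₁ e
        ... | _ | inj₁ e = inj₁ e
        ... | inj₂ (inj₁ h) | _ = inj₂ (0F , h)
        ... | _ | inj₂ (inj₁ h) = inj₂ (1F , h)
        ... | inj₂ (inj₂ h) | inj₂ (inj₂ k) = ⊥-elim (one-q ℕ.≤-refl x≤y h k λ ())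

        opposite-chords : ∀ {z z′} κ i → Chord z κ i → Chord z′ κ (next (next i)) → ⊥
        opposite-chords {z} {z′} κ i h k = opposite-ears orientation?
            (rim-from orientation? side diagonal apart κ i) h
            -- Two further steps from the opposite position lead back to `i`, by `next⁴`.
            (subst (λ l → Far z′ (pk (next (next i))) (pk (next (next (next i)))) (pk l) (pk (next l)) ⊎
                          Far z′ (pk (next (next (next i)))) (pk (next (next i))) (pk (next l)) (pk l))
                   (next⁴ i) k)
          where
          open Within (ℕ.≤-refl {Fin.toℕ x}) x≤y
          pk : Fin 4 → Point
          pk l = pt (ring κ l)

        -- Opposite sides of a ring are not both far, so each ring is split for one of the two
        -- positions; with three rings, one position is split twice.
        opposite-eared : ∀ i → Eared i → Eared (next (next i)) → ⊥
        opposite-eared i E E′ = clash (Fin.pigeonhole (ℕ.n<1+n 2) (λ κ → bit (E.split? κ)))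
          where
          module E = Eared E
          module E′ = Eared E′
          split′ : ∀ κ → ¬ E.Split κ → E′.Split κ
          split′ κ ¬split = decidable-stable (E′.split? κ) λ ¬split′ →
            opposite-chords κ i (E.chord κ ¬split) (E′.chord κ ¬split′)
          clash : ∃[ κ ] ∃[ κ′ ] κ Fin.< κ′ × bit (E.split? κ) ≡ bit (E.split? κ′) → ⊥
          clash (κ , κ′ , κ<κ′ , eq) with bit-agree (E.split? κ) (E.split? κ′) eq
          ... | inj₁ (h , k) = Fin.<⇒≢ κ<κ′ (E.unique h k)
          ... | inj₂ (¬h , ¬k) = Fin.<⇒≢ κ<κ′ (E′.unique (split′ κ ¬h) (split′ κ′ ¬k))

        one-end : ∀ {i i′} → i ≢ i′ → ∃[ j ] Visible y (q i j) → ∃[ j ] Visible y (q i′ j) → ⊥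
        one-end i≢i′ (j , h) (j′ , k) = one-q x≤y ℕ.≤-refl h k λ { refl → i≢i′ refl }

        -- Each of the two opposite pairs has a position without ears, so two different positions
        -- have a q visible at `y`.
        window-impossible : ⊥
        window-impossible with eared-or-end 0F | eared-or-end 1F | eared-or-end 2F | eared-or-end 3F
        ... | inj₁ e | _ | inj₁ e′ | _ = opposite-eared 0F e e′
        ... | _ | inj₁ e | _ | inj₁ e′ = opposite-eared 1F e e′
        ... | inj₂ h | inj₂ k | _ | _ = one-end {0F} {1F} (λ ()) h k
        ... | inj₂ h | inj₁ _ | _ | inj₂ k = one-end {0F} {3F} (λ ()) h k
        ... | inj₁ _ | inj₂ h | inj₂ k | _ = one-end {1F} {2F} (λ ()) h k
        ... | inj₁ _ | inj₁ _ | inj₂ h | inj₂ k = one-end {2F} {3F} (λ ()) h k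

      impossible : ⊥
      impossible =
        let κ , i , latest-ring   = latest (λ κ i → first (ring κ i))
            κ′ , i′ , earliest-ring = earliest (λ κ i → last (ring κ i))
        in cases κ i κ′ i′ latest-ring earliest-ring (first (ring κ i) Fin.≤? last (ring κ′ i′))
        where
        cases : ∀ κ i κ′ i′ → (∀ μ k → first (ring μ k) Fin.≤ first (ring κ i)) →
          (∀ μ k → last (ring κ′ i′) Fin.≤ last (ring μ k)) →
          Dec (first (ring κ i) Fin.≤ last (ring κ′ i′)) → ⊥
        cases κ i κ′ i′ ≤x y≤ (yes x≤y) = Window.window-impossible x≤y
          (λ x≤t t≤y μ k → ℕ.≤-trans (≤x μ k) x≤t , ℕ.≤-trans t≤y (y≤ μ k))
          (λ k j → adjacent-overlap (inj₁ (q⟶ring k j κ′ i′)))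
          (λ k j → adjacent-overlap (inj₂ (q⟶ring k j κ i)))
        -- Some ring vertex ends before another starts; every q is adjacent to both and spans the
        -- gap, so all q's share an interval.
        cases κ i κ′ i′ _ _ (no x≰y) =
          let k , j , latest-q = latest (λ k j → first (q k j))
              k′ , j′ , earliest-q = earliest (λ k j → last (q k j))
          in no-common-q-time {first (q k j)} {last (q k′ j′)}
               (ℕ.≤-trans (adjacent-overlap (inj₁ (q⟶ring k j κ′ i′)))
                 (ℕ.≤-trans (ℕ.<⇒≤ (ℕ.≰⇒> x≰y)) (adjacent-overlap (inj₂ (q⟶ring k′ j′ κ i)))))
               (λ l → uncurry latest-q (Fin.remQuot 2 l)) (λ l → uncurry earliest-q (Fin.remQuot 2 l))
               (λ l → adjacent-overlap (inj₂ (qa k′ j′ l)))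
               (λ l → adjacent-overlap (inj₁ (qa k j l)))

-- Double negation over finite sets and the conclusion

¬¬∀-Fin : ∀ {n} {P : Fin n → Set} → (∀ i → ¬ ¬ P i) → ¬ ¬ (∀ i → P i)
¬¬∀-Fin = Fin.sequence (RawMonad.rawApplicative ¬¬-Monad)

¬¬∀-V : ∀ {P : V → Set} → (∀ v → ¬ ¬ P v) → ¬ ¬ (∀ v → P v)
¬¬∀-V {P} h ¬∀ =
  ¬¬∀-Fin (λ i → h (a i)) λ pa → ¬¬∀-Fin (λ i → h (b i)) λ pb → ¬¬∀-Fin (λ i → h (c i)) λ pc →
  ¬¬∀-Fin (λ i → ¬¬∀-Fin (λ j → h (q i j))) λ pq → ¬¬∀-Fin (λ i → ¬¬∀-Fin (λ j → h (r i j))) λ pr →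
  ¬∀ λ { (a i) → pa i ; (b i) → pb i ; (c i) → pc i ; (q i j) → pq i j ; (r i j) → pr i j }

theorem2 : ¬ AdmitsPlanarGeometricStoryplan 𝔾
theorem2 (ℓ , S , planar) =
  -- The goal is a contradiction and there are finitely many triples, so all their orientations may
  -- be taken as decided.
  ¬¬∀-V (λ u → ¬¬∀-V (λ v → ¬¬∀-V (λ w → ¬¬-excluded-middle))) (impossible S planar)
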